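{- Let $n\ge 1$ and let $G$ be a connected graph on $n$ vertices. Let $K_n$ be the complete graph on $n$ vertices. Then $G\geq_e K_n$ if and only if $X_G$ is $e$-positive.
   Context: All graphs are finite and simple. The chromatic symmetric function of a graph $G$ with vertices $v_1,\dots,v_n$ is $X_G=\sum_{\kappa}x_{\kappa(v_1)}\cdots x_{\kappa(v_n)}$, summed over all proper colorings $\kappa:V(G)\to\{1,2,3,\dots\}$ (adjacent vertices get different colors); it is a homogeneous symmetric function of degree $n$ in commuting variables $x_1,x_2,\dots$ over $\mathbb{Q}$. Let $e_i$ be the $i$-th elementary symmetric function and $e_\lambda=e_{\lambda_1}e_{\lambda_2}\cdots$ for an integer partition $\lambda$; $\{e_\lambda:\lambda\vdash n\}$ is a basis of the degree-$n$ symmetric functions. $[e_\lambda]F$ denotes the coefficient of $e_\lambda$ in $F$, and $F$ is $e$-positive if $[e_\lambda]F\ge 0$ for all $\lambda$. For connected graphs $G,H$ on $n$ vertices (for which $[e_{(n)}]X_G$ and $[e_{(n)}]X_H$ are positive), set $$X_e(G,H)=X_G-\frac{[e_{(n)}]X_G}{[e_{(n)}]X_H}X_H,$$ and write $G\geq_e H$ if $X_e(G,H)$ is $e$-positive. -}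

module Defs where

open import Level using (0ℓ)
open import Data.Nat as ℕ using (ℕ; zero; suc; _∸_; _≥_; _^_)
import Data.Nat.Properties as ℕ
open import Data.Bool using (if_then_else_)
open import Data.Integer using (+_)
open import Data.Rational as ℚ using (ℚ; 0ℚ; 1ℚ)
open import Data.Fin using (Fin; finToFun)
import Data.Fin.Properties as Fin
open import Data.List using (List; []; _∷_; map; foldr; filter; length; lookup; concatMap; cartesianProductWith; upTo; allFin)
open import Data.Nat.ListAction using (sum)
open import Data.List.Relation.Unary.All as All using (All)
open import Data.List.Relation.Unary.Linked using (Linked; linked?)
open import Data.Product using (Σ; _×_; _,_)
open import Function using (_∘_)
open import Relation.Binary.Core using (Rel)
open import Relation.Binary.Definitions using (Decidable; Symmetric; Irreflexive)
open import Relation.Binary.Construct.Closure.ReflexiveTransitive using (Star)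
open import Relation.Binary.PropositionalEquality using (_≡_; _≢_; refl; sym)
open import Relation.Nullary using (Dec; ¬?; does)
open import Relation.Nullary.Decidable using (_×-dec_; _→-dec_)

------------------------------------------------------------------------
-- Finite simple graphs on the vertex set Fin n

record Graph (n : ℕ) : Set₁ where
  infix 4 _~_ _~?_
  field
    _~_    : Rel (Fin n) 0ℓ
    _~?_   : Decidable _~_
    ~-sym  : Symmetric _~_
    ~-irr  : Irreflexive _≡_ _~_

Connected : ∀ {n} → Graph n → Set
Connected G = ∀ u v → Star (Graph._~_ G) u v

K : ∀ n → Graph n
K n = record
  { _~_   = _≢_
  ; _~?_  = λ u v → ¬? (u Fin.≟ v)
  ; ~-sym = λ u≢v → u≢v ∘ sym
  ; ~-irr = λ u≡v u≢v → u≢v u≡v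
  }

------------------------------------------------------------------------
-- Formal power series over ℚ in x₁, x₂, …

-- The list a₁ ∷ … ∷ aₖ ∷ [] stands for the monomial x₁^a₁ ⋯ xₖ^aₖ.
-- Trailing zeros do not change the monomial; every series built below
-- takes the same value on all lists for one monomial.
Monomial : Set
Monomial = List ℕ

Series : Set
Series = Monomial → ℚ

infix 4 _≈_
_≈_ : Series → Series → Set
F ≈ H = ∀ m → F m ≡ H m

infixl 6 _⊕_ _⊖_
infixl 7 _⊛_
infixr 8 _·_

0ₛ : Series
0ₛ _ = 0ℚ

_⊕_ : Series → Series → Series
(F ⊕ H) m = F m ℚ.+ H m

_⊖_ : Series → Series → Series
(F ⊖ H) m = F m ℚ.- H m

_·_ : ℚ → Series → Series
(q · F) m = q ℚ.* F m

-- All pairs of monomials whose product is the given one.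
splits : Monomial → List (Monomial × Monomial)
splits []      = ([] , []) ∷ []
splits (a ∷ m) =
  cartesianProductWith (λ { i (p , q) → (i ∷ p , (a ∸ i) ∷ q) }) (upTo (suc a)) (splits m)

_⊛_ : Series → Series → Series
(F ⊛ H) m = foldr ℚ._+_ 0ℚ (map (λ { (p , q) → F p ℚ.* H q }) (splits m))

------------------------------------------------------------------------
-- Elementary symmetric functions

-- eᵢ is the sum of all squarefree monomials of degree i; in particular
-- e 0 is the constant series 1.
e : ℕ → Series
e i m = if does (All.all? (ℕ._≤? 1) m ×-dec (sum m ℕ.≟ i)) then 1ℚ else 0ℚ

e[_] : List ℕ → Series
e[ μ ] = foldr (λ i F → e i ⊛ F) (e 0) μ

------------------------------------------------------------------------
-- Integer partitions

infix 4 _⊢_ _⊢?_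
_⊢_ : List ℕ → ℕ → Set
μ ⊢ n = All ℕ.NonZero μ × Linked _≥_ μ × sum μ ≡ n

_⊢?_ : Decidable _⊢_
μ ⊢? n = All.all? ℕ.nonZero? μ ×-dec linked? ℕ._≥?_ μ ×-dec (sum μ ℕ.≟ n)

listsOfLength : {A : Set} → List A → ℕ → List (List A)
listsOfLength xs zero    = [] ∷ []
listsOfLength xs (suc k) = cartesianProductWith _∷_ xs (listsOfLength xs k)

-- Every partition of n has at most n parts, each in {1, …, n}, so each
-- occurs here exactly once.
partitions : ℕ → List (List ℕ)
partitions n =
  filter (_⊢? n) (concatMap (listsOfLength (map suc (upTo n))) (upTo (suc n)))

------------------------------------------------------------------------
-- Expansions in the basis { e_μ : μ ⊢ n } of the symmetric functions
-- homogeneous of degree n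

-- Because the e_μ form a basis, a series F has such an expansion exactly
-- when it is a symmetric function homogeneous of degree n, and then the
-- values of coeff on partitions of n are determined by F: coeff μ is [e_μ]F.
-- The values of coeff on lists that are not partitions of n play no role.
record EExpansion (n : ℕ) (F : Series) : Set where
  field
    coeff  : List ℕ → ℚ
    expand : F ≈ foldr (λ μ H → coeff μ · e[ μ ] ⊕ H) 0ₛ (partitions n)

[e_]_ : ∀ {n F} → List ℕ → EExpansion n F → ℚ
[e μ ] E = EExpansion.coeff E μ

EPositive : ℕ → Series → Set
EPositive n F = Σ (EExpansion n F) λ E → ∀ μ → μ ⊢ n → 0ℚ ℚ.≤ [e μ ] E

------------------------------------------------------------------------
-- Chromatic symmetric functions

Proper : ∀ {n k} → Graph n → (Fin n → Fin k) → Set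
Proper G κ = ∀ u v → Graph._~_ G u v → κ u ≢ κ v

proper? : ∀ {n k} (G : Graph n) (κ : Fin n → Fin k) → Dec (Proper G κ)
proper? G κ = Fin.all? λ u → Fin.all? λ v →
  Graph._~?_ G u v →-dec ¬? (κ u Fin.≟ κ v)

-- x_κ(v₁) ⋯ x_κ(vₙ) is the monomial m.
HasContent : ∀ {n} (m : Monomial) → (Fin n → Fin (length m)) → Set
HasContent {n} m κ =
  ∀ i → length (filter (λ v → κ v Fin.≟ i) (allFin n)) ≡ lookup m i

hasContent? : ∀ {n} m (κ : Fin n → Fin (length m)) → Dec (HasContent m κ)
hasContent? m κ = Fin.all? λ i → _ ℕ.≟ lookup m i

colorings : ∀ n k → List (Fin n → Fin k)
colorings n k = map finToFun (allFin (k ^ n))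

-- The coefficient of m is the number of proper colorings with monomial m;
-- such colorings only use the colors 1, …, length m.
X : ∀ {n} → Graph n → Series
X {n} G m =
  + length (filter (λ κ → proper? G κ ×-dec hasContent? m κ) (colorings n (length m))) ℚ./ 1

------------------------------------------------------------------------
-- The relation ≥ₑ

Xₑ : ∀ {n} (G H : Graph n) (EG : EExpansion n (X G)) (EH : EExpansion n (X H)) →
     .{{_ : ℚ.NonZero ([e n ∷ [] ] EH)}} → Series
Xₑ {n} G H EG EH = X G ⊖ (([e n ∷ [] ] EG) ℚ.÷ ([e n ∷ [] ] EH)) · X H

-- The coefficients used to form Xₑ are those of the (unique) expansions of
-- X G and X H; for connected H the one divided by is positive, so the
-- nonzero field is then no restriction.
infix 4 _≥ₑ_
record _≥ₑ_ {n} (G H : Graph n) : Set where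
  field
    expansionˡ : EExpansion n (X G)
    expansionʳ : EExpansion n (X H)
    nonzero    : ℚ.NonZero ([e n ∷ [] ] expansionʳ)
    positive   : EPositive n (Xₑ G H expansionˡ expansionʳ {{nonzero}})

-- Since X (K n) = n! e n, passing between X G and Xₑ G (K n) changes only the
-- coefficient of e n.  It vanishes in Xₑ G (K n), so everything rests on
-- [e n ∷ []] (X G) being nonnegative.  Up to the sign (-1)^(n-1) this
-- coefficient is the value at X G of the linear functional
--   F ↦ ∑ (-1)^(k-1) α₁ F(α₁ ∷ … ∷ αₖ ∷ [])   (α a composition of n),
-- that is, of the pairing with the power sum pₙ: it kills e[ μ ] for every
-- other μ ⊢ n.  On X G, grouping the vertices by the first color class turns
-- it into a sum over the vertices v of signed sums over stable sets, which
-- count the acyclic orientations whose unique sink is v.  Their signs follow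
-- from the recursion noSink-split, without mentioning orientations.

module Submission where

open import Defs
open import Data.Bool using (if_then_else_; true; false)
open import Data.Empty using (⊥-elim)
open import Data.Fin as Fin using (Fin; zero; suc; _↑ˡ_; _↑ʳ_; finToFun)
import Data.Fin.Properties as Fin
open import Data.Fin.Subset
  using (Subset; Side; inside; outside; _∈_; _∉_; _⊆_; _∩_; _─_; ∣_∣; ⊤; ⊥)
open import Data.Fin.Subset.Properties
  using (_∈?_; _⊆?_; drop-there; drop-∷-⊆; ∣⊤∣≡n; p─⊥≡p; ∈⊤; x∈p∩q⁻; ⊆-antisym; x∈p∧x∉q⇒x∈p─q; p─q⊆p; p∩q⊆p)
import Data.Integer as ℤ
import Data.Integer.Solver as ℤ
open import Data.List
  using (List; []; _∷_; _++_; map; foldr; filter; length; lookup; concatMap; cartesianProductWith; tabulate; allFin; upTo; applyUpTo)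
open import Data.List.Membership.Propositional renaming (_∈_ to _∈ₗ_) using ()
open import Data.List.Membership.Propositional.Properties
  using (∈-filter⁺; ∈-concatMap⁺; ∈-cartesianProductWith⁺; ∈-cartesianProductWith⁻; ∈-upTo⁺; ∈-map⁺)
import Data.List.Properties as List
open import Data.List.Relation.Binary.Disjoint.Propositional using (Disjoint)
open import Data.List.Relation.Unary.All as All using (All; []; _∷_)
import Data.List.Relation.Unary.All.Properties as All
import Data.List.Relation.Unary.AllPairs as AllPairs
import Data.List.Relation.Unary.AllPairs.Properties as AllPairs
import Data.List.Relation.Unary.Any as Any
open import Data.List.Relation.Unary.Linked using ([-])
open import Data.List.Relation.Unary.Unique.Propositional using (Unique; []; _∷_)
import Data.List.Relation.Unary.Unique.Propositional.Properties as Unique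
open import Data.Maybe as Maybe using (Maybe; just; nothing)
import Data.Maybe.Properties as Maybe
open import Data.Nat as ℕ using (ℕ; zero; suc; z≤n; s≤s; _!)
open import Data.Nat.ListAction using (sum)
import Data.Nat.Properties as ℕ
open import Data.Product using (_×_; _,_; proj₁; proj₂)
open import Data.Rational
  using (ℚ; 0ℚ; 1ℚ; _+_; _*_; -_; _/_; 1/_; _≤_; NonZero; nonNegative)
open import Data.Rational.Properties
open import Data.Rational.Solver using (module +-*-Solver)
import Data.Rational.Unnormalised as ℚᵘ
import Data.Rational.Unnormalised.Properties as ℚᵘ
open import Data.Sum using (_⊎_; inj₁; inj₂)
open import Data.Vec as Vec using (Vec; []; _∷_; _[_]≔_; here; there)
import Data.Vec.Properties as Vec
open import Function using (_∘_; id)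
open import Function.Bundles using (_⇔_; mk⇔)
open import Relation.Binary.Definitions using (Tri; tri<; tri≈; tri>)
open import Relation.Binary.PropositionalEquality
open import Relation.Nullary using (Dec; yes; no; does; ¬_; ¬?; contradiction)
open import Relation.Nullary.Decidable using (_×-dec_; _→-dec_; dec-true; dec-false)
open import Relation.Unary using (Pred; Decidable)

open +-*-Solver using (solve; _:+_; _:*_; :-_; _:=_; con)
open ℤ.+-*-Solver using ()
  renaming (solve to ℤ-solve; con to ℤ-con; _:+_ to _⊞_; _:*_ to _⊠_; _:=_ to _⊜_)
open ≡-Reasoning

-- For symmetric F, the coefficient F(α) is the Hall pairing of F with h_α. Hence the functional
-- comes from Newton's formula p_n = ∑ (-1)^(k-1) α₁ h_α, and it kills products of factors of
-- positive degree because p_n is primitive. In the same way `Z n` is the pairing with (-1)^n e_n.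
-- In the code the vanishing is a telescoping argument that moves the first exponent up one unit at
-- a time; this is why `Y` and `W` carry a lower bound for that exponent.
--
-- An `EExpansion` is data, so the coefficient of `e n` has to be tied to the series itself. The
-- functional does this: it gives the same value for every expansion of `X G`. All other
-- coefficients are carried unchanged from one expansion to the next.
--
-- The recursion over graphs deletes vertices. To avoid renumbering them, the vertex set stays
-- `Fin n` throughout, and an induced subgraph is a `Subset n`.

private variable
  A B C : Set
  P Q : Set
  n k : ℕ

-- Finite sums of rationals

ι : ℕ → ℚ
ι k = ℤ.+ k / 1

-- `_/_` divides by a gcd that does not compute for a variable `k`, so both sides are compared as
-- unnormalised fractions.
ι-suc : ∀ k → ι (suc k) ≡ 1ℚ + ι k
ι-suc k = toℚᵘ-injective (ℚᵘ.≃-trans (toℚᵘ-fromℚᵘ (ℚᵘ.mkℚᵘ (ℤ.+ suc k) 0))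
  (ℚᵘ.≃-trans (ℚᵘ.*≡* (ℤ-solve 1 (λ x → (ℤ-con (ℤ.+ 1) ⊞ x) ⊠ ℤ-con (ℤ.+ 1) ⊜
      (ℤ-con (ℤ.+ 1) ⊞ x ⊠ ℤ-con (ℤ.+ 1)) ⊠ ℤ-con (ℤ.+ 1)) refl (ℤ.+ k)))
  (ℚᵘ.≃-sym (ℚᵘ.≃-trans (toℚᵘ-homo-+ 1ℚ (ι k))
    (ℚᵘ.+-congʳ ℚᵘ.1ℚᵘ (toℚᵘ-fromℚᵘ (ℚᵘ.mkℚᵘ (ℤ.+ k) 0)))))))

ι-+ : ∀ k l → ι (k ℕ.+ l) ≡ ι k + ι l
ι-+ zero    l = sym (+-identityˡ (ι l))
ι-+ (suc k) l = begin
  ι (suc (k ℕ.+ l))     ≡⟨ ι-suc (k ℕ.+ l) ⟩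
  1ℚ + ι (k ℕ.+ l)      ≡⟨ cong (1ℚ +_) (ι-+ k l) ⟩
  1ℚ + (ι k + ι l)      ≡⟨ +-assoc 1ℚ (ι k) (ι l) ⟨
  1ℚ + ι k + ι l        ≡⟨ cong (_+ ι l) (ι-suc k) ⟨
  ι (suc k) + ι l       ∎

ι-* : ∀ k l → ι (k ℕ.* l) ≡ ι k * ι l
ι-* zero    l = sym (*-zeroˡ (ι l))
ι-* (suc k) l = begin
  ι (l ℕ.+ k ℕ.* l)     ≡⟨ ι-+ l (k ℕ.* l) ⟩
  ι l + ι (k ℕ.* l)     ≡⟨ cong (ι l +_) (ι-* k l) ⟩
  ι l + ι k * ι l       ≡⟨ solve 2 (λ x y → y :+ x :* y := (con 1ℚ :+ x) :* y) refl (ι k) (ι l) ⟩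
  (1ℚ + ι k) * ι l      ≡⟨ cong (_* ι l) (ι-suc k) ⟨
  ι (suc k) * ι l       ∎

0≤ι : ∀ k → 0ℚ ≤ ι k
0≤ι k = nonNegative⁻¹ (ι k) {{normalize-nonNeg k 1}}

-- Has the shape of the body of `e`, so that `e i m` is definitionally `𝟙 (squarefree? i m)`.
𝟙 : Dec P → ℚ
𝟙 P? = if does P? then 1ℚ else 0ℚ

𝟙-yes : (P? : Dec P) → P → 𝟙 P? ≡ 1ℚ
𝟙-yes (yes _) _ = refl
𝟙-yes (no ¬p) p = ⊥-elim (¬p p)

𝟙-no : (P? : Dec P) → ¬ P → 𝟙 P? ≡ 0ℚ
𝟙-no (yes p) ¬p = ⊥-elim (¬p p)
𝟙-no (no _)  _  = refl

𝟙-cong : (P? : Dec P) (Q? : Dec Q) → (P → Q) → (Q → P) → 𝟙 P? ≡ 𝟙 Q?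
𝟙-cong (yes p) Q? f _ = sym (𝟙-yes Q? (f p))
𝟙-cong (no ¬p) Q? _ g = sym (𝟙-no Q? (¬p ∘ g))

0≤𝟙 : (P? : Dec P) → 0ℚ ≤ 𝟙 P?
0≤𝟙 (yes _) = 0≤ι 1
0≤𝟙 (no _)  = ≤-refl

𝟙-× : (P? : Dec P) (Q? : Dec Q) → 𝟙 (P? ×-dec Q?) ≡ 𝟙 P? * 𝟙 Q?
𝟙-× (yes _) Q? = sym (*-identityˡ (𝟙 Q?))
𝟙-× (no _)  Q? = sym (*-zeroˡ (𝟙 Q?))

0≤+ : ∀ {p q} → 0ℚ ≤ p → 0ℚ ≤ q → 0ℚ ≤ p + q
0≤+ = +-mono-≤

0≤* : ∀ {p q} → 0ℚ ≤ p → 0ℚ ≤ q → 0ℚ ≤ p * q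
0≤* {p} {q} 0≤p 0≤q = nonNegative⁻¹ (p * q)
  {{nonNeg*nonNeg⇒nonNeg p {{nonNegative 0≤p}} q {{nonNegative 0≤q}}}}

∑ : List A → (A → ℚ) → ℚ
∑ []       f = 0ℚ
∑ (x ∷ xs) f = f x + ∑ xs f

infixr 6.5 ∑
syntax ∑ xs (λ x → t) = ∑[ x ← xs ] t

∑-congᴬ : ∀ {xs : List A} {f g} → All (λ x → f x ≡ g x) xs → ∑ xs f ≡ ∑ xs g
∑-congᴬ []       = refl
∑-congᴬ (p ∷ ps) = cong₂ _+_ p (∑-congᴬ ps)

∑-cong : ∀ (xs : List A) {f g} → (∀ x → f x ≡ g x) → ∑ xs f ≡ ∑ xs g
∑-cong xs p = ∑-congᴬ (All.universal p xs)

∑-zeroᴬ : ∀ {xs : List A} {f} → All (λ x → f x ≡ 0ℚ) xs → ∑ xs f ≡ 0ℚ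
∑-zeroᴬ []       = refl
∑-zeroᴬ (p ∷ ps) = cong₂ _+_ p (∑-zeroᴬ ps)

∑-zero : ∀ (xs : List A) {f} → (∀ x → f x ≡ 0ℚ) → ∑ xs f ≡ 0ℚ
∑-zero xs p = ∑-zeroᴬ (All.universal p xs)

∑-+ : ∀ (xs : List A) f g → ∑[ x ← xs ] (f x + g x) ≡ ∑ xs f + ∑ xs g
∑-+ []       f g = refl
∑-+ (x ∷ xs) f g = trans (cong (f x + g x +_) (∑-+ xs f g))
  (solve 4 (λ a b c d → a :+ b :+ (c :+ d) := a :+ c :+ (b :+ d)) refl (f x) (g x) (∑ xs f) (∑ xs g))

∑-*ˡ : ∀ q (xs : List A) f → q * ∑ xs f ≡ ∑[ x ← xs ] (q * f x)
∑-*ˡ q []       f = *-zeroʳ q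
∑-*ˡ q (x ∷ xs) f = trans (*-distribˡ-+ q (f x) (∑ xs f)) (cong (q * f x +_) (∑-*ˡ q xs f))

∑-*ʳ : ∀ q (xs : List A) f → ∑ xs f * q ≡ ∑[ x ← xs ] (f x * q)
∑-*ʳ q xs f = trans (*-comm (∑ xs f) q) (trans (∑-*ˡ q xs f) (∑-cong xs (λ x → *-comm q (f x))))

0≤∑ : ∀ {xs : List A} {f} → All (λ x → 0ℚ ≤ f x) xs → 0ℚ ≤ ∑ xs f
0≤∑ []       = ≤-refl
0≤∑ (p ∷ ps) = 0≤+ p (0≤∑ ps)

∑-swap : ∀ (xs : List A) (ys : List B) (f : A → B → ℚ) →
         ∑[ x ← xs ] ∑[ y ← ys ] f x y ≡ ∑[ y ← ys ] ∑[ x ← xs ] f x y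
∑-swap []       ys f = sym (∑-zero ys (λ _ → refl))
∑-swap (x ∷ xs) ys f = trans (cong (∑ ys (f x) +_) (∑-swap xs ys f))
  (sym (∑-+ ys (f x) (λ y → ∑[ x′ ← xs ] f x′ y)))

∑-++ : ∀ (xs ys : List A) f → ∑ (xs ++ ys) f ≡ ∑ xs f + ∑ ys f
∑-++ []       ys f = sym (+-identityˡ (∑ ys f))
∑-++ (x ∷ xs) ys f = trans (cong (f x +_) (∑-++ xs ys f)) (sym (+-assoc (f x) (∑ xs f) (∑ ys f)))

∑-map : ∀ (h : A → B) xs f → ∑ (map h xs) f ≡ ∑ xs (f ∘ h)
∑-map h []       f = refl
∑-map h (x ∷ xs) f = cong (f (h x) +_) (∑-map h xs f)

∑-foldr : ∀ (h : A → ℚ) xs → foldr _+_ 0ℚ (map h xs) ≡ ∑ xs h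
∑-foldr h []       = refl
∑-foldr h (x ∷ xs) = cong (h x +_) (∑-foldr h xs)

∑-cartesianProductWith : ∀ (h : A → B → C) xs ys f →
  ∑ (cartesianProductWith h xs ys) f ≡ ∑[ x ← xs ] ∑[ y ← ys ] f (h x y)
∑-cartesianProductWith h []       ys f = refl
∑-cartesianProductWith h (x ∷ xs) ys f = trans (∑-++ (map (h x) ys) _ f)
  (cong₂ _+_ (∑-map (h x) ys f) (∑-cartesianProductWith h xs ys f))

∑-tabulate : ∀ {k} (h : Fin k → A) f → ∑ (tabulate h) f ≡ ∑ (allFin k) (f ∘ h)
∑-tabulate {k = zero}  h f = refl
∑-tabulate {k = suc k} h f = cong (f (h zero) +_)
  (trans (∑-tabulate (h ∘ suc) f) (sym (∑-tabulate suc (f ∘ h))))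

∑-allFin-suc : ∀ k f → ∑ (allFin (suc k)) f ≡ f zero + ∑ (allFin k) (f ∘ suc)
∑-allFin-suc k f = cong (f zero +_) (∑-tabulate suc f)

∑-allFin-+ : ∀ k l f → ∑ (allFin (k ℕ.+ l)) f ≡ ∑[ i ← allFin k ] f (i ↑ˡ l) + ∑[ j ← allFin l ] f (k ↑ʳ j)
∑-allFin-+ zero    l f = sym (+-identityˡ (∑ (allFin l) f))
∑-allFin-+ (suc k) l f = begin
  ∑ (allFin (suc k ℕ.+ l)) f
    ≡⟨ ∑-allFin-suc (k ℕ.+ l) f ⟩
  f zero + ∑ (allFin (k ℕ.+ l)) (f ∘ suc)
    ≡⟨ cong (f zero +_) (∑-allFin-+ k l (f ∘ suc)) ⟩
  f zero + (∑[ i ← allFin k ] f (suc (i ↑ˡ l)) + ∑[ j ← allFin l ] f (suc (k ↑ʳ j)))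
    ≡⟨ +-assoc (f zero) _ _ ⟨
  f zero + ∑[ i ← allFin k ] f (suc (i ↑ˡ l)) + ∑[ j ← allFin l ] f (suc (k ↑ʳ j))
    ≡⟨ cong (_+ ∑[ j ← allFin l ] f (suc (k ↑ʳ j))) (∑-allFin-suc k (λ i → f (i ↑ˡ l))) ⟨
  ∑[ i ← allFin (suc k) ] f (i ↑ˡ l) + ∑[ j ← allFin l ] f (suc (k ↑ʳ j)) ∎

∑-allFin-* : ∀ k l f → ∑ (allFin (k ℕ.* l)) f ≡ ∑[ i ← allFin k ] ∑[ j ← allFin l ] f (Fin.combine i j)
∑-allFin-* zero    l f = refl
∑-allFin-* (suc k) l f = begin
  ∑ (allFin (l ℕ.+ k ℕ.* l)) f
    ≡⟨ ∑-allFin-+ l (k ℕ.* l) f ⟩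
  ∑[ j ← allFin l ] f (j ↑ˡ (k ℕ.* l)) + ∑ (allFin (k ℕ.* l)) (f ∘ (l ↑ʳ_))
    ≡⟨ cong (∑[ j ← allFin l ] f (j ↑ˡ (k ℕ.* l)) +_) (∑-allFin-* k l (f ∘ (l ↑ʳ_))) ⟩
  ∑[ j ← allFin l ] f (j ↑ˡ (k ℕ.* l)) + ∑[ i ← allFin k ] ∑[ j ← allFin l ] f (l ↑ʳ Fin.combine i j)
    ≡⟨ ∑-allFin-suc k (λ i → ∑[ j ← allFin l ] f (Fin.combine i j)) ⟨
  ∑[ i ← allFin (suc k) ] ∑[ j ← allFin l ] f (Fin.combine i j) ∎

ι-filter : {P : Pred A _} (P? : Decidable P) → ∀ xs → ι (length (filter P? xs)) ≡ ∑[ x ← xs ] 𝟙 (P? x)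
ι-filter P? []       = refl
ι-filter P? (x ∷ xs) with P? x
... | yes _ = trans (ι-suc (length (filter P? xs))) (cong (1ℚ +_) (ι-filter P? xs))
... | no  _ = trans (ι-filter P? xs) (sym (+-identityˡ _))

-- Solutions of `P` are unique and the list has no repetitions, so a single term survives. This
-- isolates the one-part partition in an expansion.
∑-pick : {P : Pred A _} (P? : Decidable P) → (∀ {x y} → P x → P y → x ≡ y) →
         ∀ {x xs} → Unique xs → x ∈ₗ xs → P x → ∀ (f : A → ℚ) → ∑[ y ← xs ] (𝟙 (P? y) * f y) ≡ f x
∑-pick P? P-unique {xs = y ∷ xs} (y≢ ∷ u) (Any.here refl) px f = begin
  𝟙 (P? y) * f y + ∑[ z ← xs ] (𝟙 (P? z) * f z)
    ≡⟨ cong₂ _+_ (trans (cong (_* f y) (𝟙-yes (P? y) px)) (*-identityˡ (f y)))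
         (∑-zeroᴬ (All.map (λ {z} y≢z → trans (cong (_* f z) (𝟙-no (P? z) (y≢z ∘ P-unique px))) (*-zeroˡ (f z))) y≢)) ⟩
  f y + 0ℚ ≡⟨ +-identityʳ (f y) ⟩
  f y ∎
∑-pick P? P-unique {x} {y ∷ xs} (y≢ ∷ u) (Any.there x∈) px f = trans
  (cong (_+ ∑[ z ← xs ] (𝟙 (P? z) * f z))
    (trans (cong (_* f y) (𝟙-no (P? y) (λ py → All.lookup y≢ x∈ (P-unique py px)))) (*-zeroˡ (f y))))
  (trans (+-identityˡ _) (∑-pick P? P-unique u x∈ px f))

-- Products with elementary symmetric functions

squarefree? : ∀ i m → Dec (All (ℕ._≤ 1) m × sum m ≡ i)
squarefree? i m = All.all? (ℕ._≤? 1) m ×-dec (sum m ℕ.≟ i)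

e-zero∷ : ∀ i m → e i (0 ∷ m) ≡ e i m
e-zero∷ i m = 𝟙-cong (squarefree? i (0 ∷ m)) (squarefree? i m)
  (λ { (_ ∷ ps , q) → ps , q }) (λ { (ps , q) → z≤n ∷ ps , q })

e-one∷ : ∀ i m → e (suc i) (1 ∷ m) ≡ e i m
e-one∷ i m = 𝟙-cong (squarefree? (suc i) (1 ∷ m)) (squarefree? i m)
  (λ { (_ ∷ ps , q) → ps , ℕ.suc-injective q }) (λ { (ps , q) → s≤s z≤n ∷ ps , cong suc q })

e₀-suc∷ : ∀ a m → e 0 (suc a ∷ m) ≡ 0ℚ
e₀-suc∷ a m = 𝟙-no (squarefree? 0 (suc a ∷ m)) λ { (_ , ()) }

e-2+∷ : ∀ i a m → e i (suc (suc a) ∷ m) ≡ 0ℚ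
e-2+∷ i a m = 𝟙-no (squarefree? i (suc (suc a) ∷ m)) λ { (s≤s () ∷ _ , _) }

-- F ⟨ a ⟩ collects the terms of F in which x₁ has exponent a.
infixl 9 _⟨_⟩
_⟨_⟩ : Series → ℕ → Series
(F ⟨ a ⟩) m = F (a ∷ m)

⊛-∑ : ∀ F H m → (F ⊛ H) m ≡ ∑[ s ← splits m ] (F (proj₁ s) * H (proj₂ s))
⊛-∑ F H m = ∑-foldr _ (splits m)

⊛-cong : ∀ {F F′ H H′} → F ≈ F′ → H ≈ H′ → F ⊛ H ≈ F′ ⊛ H′
⊛-cong {F} {F′} {H} {H′} p q m = trans (⊛-∑ F H m) (trans
  (∑-cong (splits m) (λ s → cong₂ _*_ (p (proj₁ s)) (q (proj₂ s)))) (sym (⊛-∑ F′ H′ m)))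

⊛-∷ : ∀ F H a m → (F ⊛ H) (a ∷ m) ≡
      ∑[ i ← upTo (suc a) ] (F ⟨ i ⟩ ⊛ H ⟨ a ℕ.∸ i ⟩) m
⊛-∷ F H a m = begin
  (F ⊛ H) (a ∷ m)
    ≡⟨ ⊛-∑ F H (a ∷ m) ⟩
  ∑[ s ← splits (a ∷ m) ] (F (proj₁ s) * H (proj₂ s))
    ≡⟨ ∑-cartesianProductWith _ (upTo (suc a)) (splits m) _ ⟩
  ∑[ i ← upTo (suc a) ] ∑[ s ← splits m ] (F (i ∷ proj₁ s) * H (a ℕ.∸ i ∷ proj₂ s))
    ≡⟨ ∑-cong (upTo (suc a)) (λ i → sym (⊛-∑ (F ⟨ i ⟩) (H ⟨ a ℕ.∸ i ⟩) m)) ⟩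
  ∑[ i ← upTo (suc a) ] (F ⟨ i ⟩ ⊛ H ⟨ a ℕ.∸ i ⟩) m ∎

⊛-zeroˡ : ∀ {F} → (∀ m → F m ≡ 0ℚ) → ∀ H m → (F ⊛ H) m ≡ 0ℚ
⊛-zeroˡ {F} p H m = trans (⊛-∑ F H m)
  (∑-zero (splits m) (λ s → trans (cong (_* H (proj₂ s)) (p (proj₁ s))) (*-zeroˡ (H (proj₂ s)))))

⊛-[] : ∀ F H → (F ⊛ H) [] ≡ F [] * H []
⊛-[] F H = +-identityʳ (F [] * H [])

e⊛-[] : ∀ j H → (e (suc j) ⊛ H) [] ≡ 0ℚ
e⊛-[] j H = trans (⊛-[] (e (suc j)) H) (*-zeroˡ (H []))

e⊛-zero∷ : ∀ j H m → (e j ⊛ H) (0 ∷ m) ≡ (e j ⊛ H ⟨ 0 ⟩) m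
e⊛-zero∷ j H m = trans (⊛-∷ (e j) H 0 m)
  (trans (+-identityʳ _) (⊛-cong (e-zero∷ j) (λ _ → refl) m))

-- `e j` has degree at most one in x₁, so only the splits with exponent 0 or 1 on the left survive.
-- This two-term rule drives every computation with `Y`, `Z` and `W` on products.
e⊛-suc∷′ : ∀ j H b m → (e j ⊛ H) (suc b ∷ m) ≡ (e j ⊛ H ⟨ suc b ⟩) m + (e j ⟨ 1 ⟩ ⊛ H ⟨ b ⟩) m
e⊛-suc∷′ j H b m = begin
  (e j ⊛ H) (suc b ∷ m)
    ≡⟨ ⊛-∷ (e j) H (suc b) m ⟩
  (e j ⟨ 0 ⟩ ⊛ H ⟨ suc b ⟩) m + ((e j ⟨ 1 ⟩ ⊛ H ⟨ b ⟩) m +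
    ∑[ i ← applyUpTo (2 ℕ.+_) b ] (e j ⟨ i ⟩ ⊛ H ⟨ suc b ℕ.∸ i ⟩) m)
    ≡⟨ cong₂ (λ x y → x + ((e j ⟨ 1 ⟩ ⊛ H ⟨ b ⟩) m + y)) (⊛-cong (e-zero∷ j) (λ _ → refl) m)
         (∑-zeroᴬ (All.applyUpTo⁺₂ (2 ℕ.+_) b (λ i → ⊛-zeroˡ (e-2+∷ j i) (H ⟨ suc b ℕ.∸ suc (suc i) ⟩) m))) ⟩
  (e j ⊛ H ⟨ suc b ⟩) m + ((e j ⟨ 1 ⟩ ⊛ H ⟨ b ⟩) m + 0ℚ)
    ≡⟨ cong ((e j ⊛ H ⟨ suc b ⟩) m +_) (+-identityʳ _) ⟩
  (e j ⊛ H ⟨ suc b ⟩) m + (e j ⟨ 1 ⟩ ⊛ H ⟨ b ⟩) m ∎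

e⊛-suc∷ : ∀ j H b m → (e (suc j) ⊛ H) (suc b ∷ m) ≡ (e (suc j) ⊛ H ⟨ suc b ⟩) m + (e j ⊛ H ⟨ b ⟩) m
e⊛-suc∷ j H b m = trans (e⊛-suc∷′ (suc j) H b m)
  (cong ((e (suc j) ⊛ H ⟨ suc b ⟩) m +_) (⊛-cong (e-one∷ j) (λ _ → refl) m))

e₀-identityˡ : ∀ H → e 0 ⊛ H ≈ H
e₀-identityˡ H []          = trans (⊛-[] (e 0) H) (*-identityˡ (H []))
e₀-identityˡ H (zero ∷ m)  = trans (e⊛-zero∷ 0 H m) (e₀-identityˡ (H ⟨ 0 ⟩) m)
e₀-identityˡ H (suc b ∷ m) = trans (e⊛-suc∷′ 0 H b m)
  (trans (cong₂ _+_ (e₀-identityˡ (H ⟨ suc b ⟩) m) (⊛-zeroˡ (e₀-suc∷ 0) (H ⟨ b ⟩) m)) (+-identityʳ _))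

e₀-identityʳ : ∀ i → e i ⊛ e 0 ≈ e i
e₀-identityʳ zero    = e₀-identityˡ (e 0)
e₀-identityʳ (suc i) []          = e⊛-[] i (e 0)
e₀-identityʳ (suc i) (zero ∷ m)  = begin
  (e (suc i) ⊛ e 0) (0 ∷ m)   ≡⟨ e⊛-zero∷ (suc i) (e 0) m ⟩
  (e (suc i) ⊛ e 0 ⟨ 0 ⟩) m   ≡⟨ ⊛-cong {e (suc i)} (λ _ → refl) (e-zero∷ 0) m ⟩
  (e (suc i) ⊛ e 0) m         ≡⟨ e₀-identityʳ (suc i) m ⟩
  e (suc i) m                 ≡⟨ e-zero∷ (suc i) m ⟨
  e (suc i) (0 ∷ m)           ∎
e₀-identityʳ (suc i) (suc b ∷ m) = begin
  (e (suc i) ⊛ e 0) (suc b ∷ m)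
    ≡⟨ e⊛-suc∷ i (e 0) b m ⟩
  (e (suc i) ⊛ e 0 ⟨ suc b ⟩) m + (e i ⊛ e 0 ⟨ b ⟩) m
    ≡⟨ cong₂ _+_ (⊛-zeroʳ (e (suc i)) (e₀-suc∷ b) m) (go b) ⟩
  0ℚ + e (suc i) (suc b ∷ m)
    ≡⟨ +-identityˡ _ ⟩
  e (suc i) (suc b ∷ m) ∎
  where
  ⊛-zeroʳ : ∀ F {H} → (∀ m → H m ≡ 0ℚ) → ∀ m → (F ⊛ H) m ≡ 0ℚ
  ⊛-zeroʳ F {H} p m = trans (⊛-∑ F H m)
    (∑-zero (splits m) (λ s → trans (cong (F (proj₁ s) *_) (p (proj₂ s))) (*-zeroʳ (F (proj₁ s)))))
  go : ∀ b → (e i ⊛ e 0 ⟨ b ⟩) m ≡ e (suc i) (suc b ∷ m)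
  go zero    = trans (⊛-cong {e i} (λ _ → refl) (e-zero∷ 0) m) (trans (e₀-identityʳ i m) (sym (e-one∷ i m)))
  go (suc b) = trans (⊛-zeroʳ (e i) (e₀-suc∷ b) m) (sym (e-2+∷ (suc i) b m))

-- Insensitivity to zero exponents

IgnoresZeros : Series → Set
IgnoresZeros F = ∀ p q → F (p ++ 0 ∷ q) ≡ F (p ++ q)

-- Zeros are allowed at every position, not just in front, so that the property passes to slices;
-- the inductions below replace `H` by its slices.
⟨⟩-ignoresZeros : ∀ F → IgnoresZeros F → ∀ a → IgnoresZeros (F ⟨ a ⟩)
⟨⟩-ignoresZeros F F-iz a p = F-iz (a ∷ p)

e₀-ignoresZeros : IgnoresZeros (e 0)
e₀-ignoresZeros []          q = e-zero∷ 0 q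
e₀-ignoresZeros (zero ∷ p)  q = trans (e-zero∷ 0 (p ++ 0 ∷ q))
  (trans (e₀-ignoresZeros p q) (sym (e-zero∷ 0 (p ++ q))))
e₀-ignoresZeros (suc a ∷ p) q = trans (e₀-suc∷ a (p ++ 0 ∷ q)) (sym (e₀-suc∷ a (p ++ q)))

e⊛-ignoresZeros : ∀ j {H} → IgnoresZeros H → IgnoresZeros (e j ⊛ H)
e⊛-ignoresZeros zero    {H} H-iz p q = trans (e₀-identityˡ H (p ++ 0 ∷ q))
  (trans (H-iz p q) (sym (e₀-identityˡ H (p ++ q))))
e⊛-ignoresZeros (suc j) {H} H-iz [] q = trans (e⊛-zero∷ (suc j) H q)
  (⊛-cong {e (suc j)} (λ _ → refl) (H-iz []) q)
e⊛-ignoresZeros (suc j) {H} H-iz (zero ∷ p) q = trans (e⊛-zero∷ (suc j) H (p ++ 0 ∷ q))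
  (trans (e⊛-ignoresZeros (suc j) (⟨⟩-ignoresZeros H H-iz 0) p q) (sym (e⊛-zero∷ (suc j) H (p ++ q))))
e⊛-ignoresZeros (suc j) {H} H-iz (suc b ∷ p) q = trans (e⊛-suc∷ j H b (p ++ 0 ∷ q))
  (trans (cong₂ _+_ (e⊛-ignoresZeros (suc j) (⟨⟩-ignoresZeros H H-iz (suc b)) p q)
                    (e⊛-ignoresZeros j (⟨⟩-ignoresZeros H H-iz b) p q))
         (sym (e⊛-suc∷ j H b (p ++ q))))

e[]-ignoresZeros : ∀ μ → IgnoresZeros e[ μ ]
e[]-ignoresZeros []      = e₀-ignoresZeros
e[]-ignoresZeros (i ∷ μ) = e⊛-ignoresZeros i (e[]-ignoresZeros μ)

-- Y n b F is the sum of (-1)^(k-1) F (c₁ ∷ … ∷ cₖ ∷ []) over all k ≥ 1, c₁ ≥ b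
-- and c₂, …, cₖ ≥ 1 with c₁ + ⋯ + cₖ = n + b; in W n b F each term is
-- multiplied by c₁, and Z n F is the sum of (-1)^k F α over all
-- compositions α of n.
Y : ℕ → ℕ → Series → ℚ
Y zero    b F = F (b ∷ [])
Y (suc n) b F = Y n (suc b) F + - Y n 1 (F ⟨ b ⟩)

Z : ℕ → Series → ℚ
Z zero    F = F []
Z (suc n) F = - Y n 1 F

W : ℕ → ℕ → Series → ℚ
W zero    b F = ι b * F (b ∷ [])
W (suc n) b F = W n (suc b) F + ι b * Z (suc n) (F ⟨ b ⟩)

-- Linearity of the signed sums over compositions

Y-cong : ∀ n b {F H} → F ≈ H → Y n b F ≡ Y n b H
Y-cong zero    b p = p (b ∷ [])
Y-cong (suc n) b p = cong₂ (λ x y → x + - y) (Y-cong n (suc b) p) (Y-cong n 1 (p ∘ (b ∷_)))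

Z-cong : ∀ n {F H} → F ≈ H → Z n F ≡ Z n H
Z-cong zero    p = p []
Z-cong (suc n) p = cong -_ (Y-cong n 1 p)

W-cong : ∀ n b {F H} → F ≈ H → W n b F ≡ W n b H
W-cong zero    b p = cong (ι b *_) (p (b ∷ []))
W-cong (suc n) b p = cong₂ (λ x y → x + ι b * y) (W-cong n (suc b) p) (Z-cong (suc n) (p ∘ (b ∷_)))

Y-⊕ : ∀ n b F H → Y n b (F ⊕ H) ≡ Y n b F + Y n b H
Y-⊕ zero    b F H = refl
Y-⊕ (suc n) b F H = trans (cong₂ (λ x y → x + - y) (Y-⊕ n (suc b) F H) (Y-⊕ n 1 (F ⟨ b ⟩) (H ⟨ b ⟩)))
  (solve 4 (λ x y z t → (x :+ y) :+ :- (z :+ t) := (x :+ :- z) :+ (y :+ :- t)) refl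
    (Y n (suc b) F) (Y n (suc b) H) (Y n 1 (F ⟨ b ⟩)) (Y n 1 (H ⟨ b ⟩)))

Z-⊕ : ∀ n F H → Z n (F ⊕ H) ≡ Z n F + Z n H
Z-⊕ zero    F H = refl
Z-⊕ (suc n) F H = trans (cong -_ (Y-⊕ n 1 F H)) (neg-distrib-+ (Y n 1 F) (Y n 1 H))

Y-· : ∀ n b q F → Y n b (q · F) ≡ q * Y n b F
Y-· zero    b q F = refl
Y-· (suc n) b q F = trans (cong₂ (λ x y → x + - y) (Y-· n (suc b) q F) (Y-· n 1 q (F ⟨ b ⟩)))
  (solve 3 (λ q x y → q :* x :+ :- (q :* y) := q :* (x :+ :- y)) refl q (Y n (suc b) F) (Y n 1 (F ⟨ b ⟩)))

Z-· : ∀ n q F → Z n (q · F) ≡ q * Z n F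
Z-· zero    q F = refl
Z-· (suc n) q F = trans (cong -_ (Y-· n 1 q F)) (neg-distribʳ-* q (Y n 1 F))

W-⊕ : ∀ n b F H → W n b (F ⊕ H) ≡ W n b F + W n b H
W-⊕ zero    b F H = *-distribˡ-+ (ι b) (F (b ∷ [])) (H (b ∷ []))
W-⊕ (suc n) b F H = trans (cong₂ (λ x y → x + ι b * y) (W-⊕ n (suc b) F H) (Z-⊕ (suc n) (F ⟨ b ⟩) (H ⟨ b ⟩)))
  (solve 5 (λ q x y z t → (x :+ y) :+ q :* (z :+ t) := (x :+ q :* z) :+ (y :+ q :* t)) refl (ι b)
    (W n (suc b) F) (W n (suc b) H) (Z (suc n) (F ⟨ b ⟩)) (Z (suc n) (H ⟨ b ⟩)))

W-· : ∀ n b q F → W n b (q · F) ≡ q * W n b F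
W-· zero    b q F = solve 3 (λ b q x → b :* (q :* x) := q :* (b :* x)) refl (ι b) q (F (b ∷ []))
W-· (suc n) b q F = trans (cong₂ (λ x y → x + ι b * y) (W-· n (suc b) q F) (Z-· (suc n) q (F ⟨ b ⟩)))
  (solve 4 (λ b q x y → q :* x :+ b :* (q :* y) := q :* (x :+ b :* y)) refl
    (ι b) q (W n (suc b) F) (Z (suc n) (F ⟨ b ⟩)))

Z-0ₛ : ∀ n → Z n 0ₛ ≡ 0ℚ
Z-0ₛ n = trans (Z-cong n (λ _ → sym (*-zeroˡ 0ℚ))) (trans (Z-· n 0ℚ 0ₛ) (*-zeroˡ (Z n 0ₛ)))

W-0ₛ : ∀ n b → W n b 0ₛ ≡ 0ℚ
W-0ₛ n b = trans (W-cong n b (λ _ → sym (*-zeroˡ 0ℚ))) (trans (W-· n b 0ℚ 0ₛ) (*-zeroˡ (W n b 0ₛ)))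

∑ₛ : List A → (A → Series) → Series
∑ₛ xs F m = ∑[ x ← xs ] F x m

Z-∑ : ∀ n (xs : List A) F → Z n (∑ₛ xs F) ≡ ∑[ x ← xs ] Z n (F x)
Z-∑ n []       F = Z-0ₛ n
Z-∑ n (x ∷ xs) F = trans (Z-⊕ n (F x) (∑ₛ xs F)) (cong (Z n (F x) +_) (Z-∑ n xs F))

W-∑ : ∀ n b (xs : List A) F → W n b (∑ₛ xs F) ≡ ∑[ x ← xs ] W n b (F x)
W-∑ n b []       F = W-0ₛ n b
W-∑ n b (x ∷ xs) F = trans (W-⊕ n b (F x) (∑ₛ xs F)) (cong (W n b (F x) +_) (W-∑ n b xs F))

-- Dropping a leading zero matches the sequences with c₁ = 0 with those with c₁ ≥ 1. It shortens the
-- sequence by one, so matched terms cancel. The total `suc n` is positive, so something is left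
-- after dropping.
Y-Z : ∀ n F → F ⟨ 0 ⟩ ≈ F → Y (suc n) 0 F ≡ 0ℚ
Y-Z n F F₀≈F = trans (cong (λ x → Y n 1 F + - x) (Y-cong n 1 F₀≈F)) (+-inverseʳ (Y n 1 F))

-- down j f n is (-1)^j f (n - j), or 0 if j > n.
down : ℕ → (ℕ → ℚ) → ℕ → ℚ
down zero    f n       = f n
down (suc j) f zero    = 0ℚ
down (suc j) f (suc n) = - down j f n

-- The signed sums on products with elementary symmetric functions

Zn : Series → ℕ → ℚ
Zn F n = Z n F

Yn : ℕ → Series → ℕ → ℚ
Yn b F n = Y n b F

down-cong : ∀ j n {f g} → (∀ n → f n ≡ g n) → down j f n ≡ down j g n
down-cong zero    n       p = p n
down-cong (suc j) zero    p = refl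
down-cong (suc j) (suc n) p = cong -_ (down-cong j n p)

-- The general `b` lets the induction close. By `e⊛-suc∷` each slice splits in two, and the part
-- that still carries `e (suc j)` cancels the value of the tail with the larger bound.
Y-e⊛ : ∀ n b j H → IgnoresZeros H → Y n (suc b) (e (suc j) ⊛ H) ≡ down j (Zn (H ⟨ b ⟩)) n
-- In terms of the Hall pairing: the coproduct of e_n is ∑ e_i ⊗ e_(n-i), and e_i pairs with e_j to
-- 1 if i = j and to 0 otherwise.
Z-e⊛ : ∀ n j H → IgnoresZeros H → Z n (e j ⊛ H) ≡ down j (Zn H) n

Z-e⊛ n       zero    H H-iz = Z-cong n (e₀-identityˡ H)
Z-e⊛ zero    (suc j) H H-iz = e⊛-[] j H
Z-e⊛ (suc n) (suc j) H H-iz = cong -_ (trans (Y-e⊛ n 0 j H H-iz)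
  (down-cong j n (λ k → Z-cong k (H-iz []))))

Y-e⊛ zero b zero    H H-iz = begin
  (e 1 ⊛ H) (suc b ∷ [])                       ≡⟨ e⊛-suc∷ 0 H b [] ⟩
  (e 1 ⊛ H ⟨ suc b ⟩) [] + (e 0 ⊛ H ⟨ b ⟩) []  ≡⟨ cong₂ _+_ (e⊛-[] 0 (H ⟨ suc b ⟩)) (e₀-identityˡ (H ⟨ b ⟩) []) ⟩
  0ℚ + H (b ∷ [])                              ≡⟨ +-identityˡ _ ⟩
  H (b ∷ [])                                   ∎
Y-e⊛ zero b (suc j) H H-iz = trans (e⊛-suc∷ (suc j) H b [])
  (cong₂ _+_ (e⊛-[] (suc j) (H ⟨ suc b ⟩)) (e⊛-[] j (H ⟨ b ⟩)))
Y-e⊛ (suc n) b j H H-iz = begin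
  Y n (2 ℕ.+ b) G + Z (suc n) (G ⟨ suc b ⟩)
    ≡⟨ cong (Y n (2 ℕ.+ b) G +_) (Z-cong (suc n) (e⊛-suc∷ j H b)) ⟩
  Y n (2 ℕ.+ b) G + Z (suc n) ((e (suc j) ⊛ H ⟨ suc b ⟩) ⊕ (e j ⊛ H ⟨ b ⟩))
    ≡⟨ cong (Y n (2 ℕ.+ b) G +_) (Z-⊕ (suc n) (e (suc j) ⊛ H ⟨ suc b ⟩) (e j ⊛ H ⟨ b ⟩)) ⟩
  Y n (2 ℕ.+ b) G + (Z (suc n) (e (suc j) ⊛ H ⟨ suc b ⟩) + Z (suc n) (e j ⊛ H ⟨ b ⟩))
    ≡⟨ cong₂ _+_ (Y-e⊛ n (suc b) j H H-iz) (cong₂ _+_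
         (Z-e⊛ (suc n) (suc j) (H ⟨ suc b ⟩) (⟨⟩-ignoresZeros H H-iz (suc b)))
         (Z-e⊛ (suc n) j (H ⟨ b ⟩) (⟨⟩-ignoresZeros H H-iz b))) ⟩
  x + (- x + y)
    ≡⟨ solve 2 (λ x y → x :+ (:- x :+ y) := y) refl x y ⟩
  y ∎
  where
  G = e (suc j) ⊛ H
  x = down j (Zn (H ⟨ suc b ⟩)) n
  y = down j (Zn (H ⟨ b ⟩)) (suc n)

-- The recursion for `Y` carried through the shift. Where the shift ends at index 0, `Y` has only
-- one term, and the default 0 of `down` stands for the missing one.
down-Y : ∀ j n b F → down j (Yn b F) (suc n) ≡ down j (Zn (F ⟨ b ⟩)) (suc n) + down j (Yn (suc b) F) n
down-Y zero    n       b F = +-comm (Y n (suc b) F) (Z (suc n) (F ⟨ b ⟩))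
down-Y (suc zero)    zero b F = sym (+-identityʳ _)
down-Y (suc (suc j)) zero b F = refl
down-Y (suc j) (suc n) b F = trans (cong -_ (down-Y j n b F))
  (neg-distrib-+ (down j (Zn (F ⟨ b ⟩)) (suc n)) (down j (Yn (suc b) F) n))

-- The telescoping of `Y-e⊛` with weights. Consecutive weights differ by 1, and the surplus units
-- add up to the `Y` term. For b = 0 only that term is left.
W-e⊛ : ∀ n b j H → IgnoresZeros H →
       W n (suc b) (e (suc j) ⊛ H) ≡ ι b * down j (Zn (H ⟨ b ⟩)) n + down j (Yn b H) n
W-e⊛ zero b zero H H-iz = begin
  ι (suc b) * (e 1 ⊛ H) (suc b ∷ [])   ≡⟨ cong₂ _*_ (ι-suc b) (Y-e⊛ 0 b 0 H H-iz) ⟩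
  (1ℚ + ι b) * H (b ∷ [])              ≡⟨ solve 2 (λ b x → (con 1ℚ :+ b) :* x := b :* x :+ x) refl (ι b) (H (b ∷ [])) ⟩
  ι b * H (b ∷ []) + H (b ∷ [])        ∎
W-e⊛ zero b (suc j) H H-iz = trans (cong (ι (suc b) *_) (Y-e⊛ 0 b (suc j) H H-iz))
  (trans (*-zeroʳ (ι (suc b))) (sym (trans (+-identityʳ _) (*-zeroʳ (ι b)))))
W-e⊛ (suc n) b j H H-iz = begin
  W n (2 ℕ.+ b) G + ι (suc b) * Z (suc n) (G ⟨ suc b ⟩)
    ≡⟨ cong (λ x → W n (2 ℕ.+ b) G + ι (suc b) * x) (Z-cong (suc n) (e⊛-suc∷ j H b)) ⟩
  W n (2 ℕ.+ b) G + ι (suc b) * Z (suc n) ((e (suc j) ⊛ H ⟨ suc b ⟩) ⊕ (e j ⊛ H ⟨ b ⟩))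
    ≡⟨ cong (λ x → W n (2 ℕ.+ b) G + ι (suc b) * x)
         (Z-⊕ (suc n) (e (suc j) ⊛ H ⟨ suc b ⟩) (e j ⊛ H ⟨ b ⟩)) ⟩
  W n (2 ℕ.+ b) G + ι (suc b) * (Z (suc n) (e (suc j) ⊛ H ⟨ suc b ⟩) + Z (suc n) (e j ⊛ H ⟨ b ⟩))
    ≡⟨ cong₂ (λ u v → u + ι (suc b) * v) (W-e⊛ n (suc b) j H H-iz) (cong₂ _+_
         (Z-e⊛ (suc n) (suc j) (H ⟨ suc b ⟩) (⟨⟩-ignoresZeros H H-iz (suc b)))
         (Z-e⊛ (suc n) j (H ⟨ b ⟩) (⟨⟩-ignoresZeros H H-iz b))) ⟩
  (ι (suc b) * x + t) + ι (suc b) * (- x + y)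
    ≡⟨ cong (λ c → (c * x + t) + c * (- x + y)) (ι-suc b) ⟩
  ((1ℚ + ι b) * x + t) + (1ℚ + ι b) * (- x + y)
    ≡⟨ solve 4 (λ b x y t → ((con 1ℚ :+ b) :* x :+ t) :+ (con 1ℚ :+ b) :* (:- x :+ y) := b :* y :+ (y :+ t))
         refl (ι b) x y t ⟩
  ι b * y + (y + t)
    ≡⟨ cong (ι b * y +_) (down-Y j n b H) ⟨
  ι b * y + down j (Yn b H) (suc n) ∎
  where
  G = e (suc j) ⊛ H
  x = down j (Zn (H ⟨ suc b ⟩)) n
  y = down j (Zn (H ⟨ b ⟩)) (suc n)
  t = down j (Yn (suc b) H) n

-- The functional on the elementary basis

sgn : ℕ → ℚ
sgn zero    = 1ℚ
sgn (suc n) = - sgn n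

sgn² : ∀ n → sgn n * sgn n ≡ 1ℚ
sgn² zero    = refl
sgn² (suc n) = trans (solve 1 (λ x → (:- x) :* (:- x) := x :* x) refl (sgn n)) (sgn² n)

down-diag : ∀ j f → down j f j ≡ sgn j * f 0
down-diag zero    f = sym (*-identityˡ (f 0))
down-diag (suc j) f = trans (cong -_ (down-diag j f)) (neg-distribˡ-* (sgn j) (f 0))

down-zero : ∀ j k f → (∀ n → f (suc n) ≡ 0ℚ) → down j f (j ℕ.+ suc k) ≡ 0ℚ
down-zero zero    k f p = p k
down-zero (suc j) k f p = cong -_ (down-zero j k f p)

W-e⊛′ : ∀ n j H → IgnoresZeros H → W n 1 (e (suc j) ⊛ H) ≡ down j (Yn 0 H) n
W-e⊛′ n j H H-iz = trans (W-e⊛ n 0 j H H-iz)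
  (trans (cong (_+ down j (Yn 0 H) n) (*-zeroˡ (down j (Zn (H ⟨ 0 ⟩)) n))) (+-identityˡ _))

-- The shift uses up the whole index, and `Y 0 0 (e 0)` is the constant term 1; the cancellation of
-- `Y-Z` starts only at index 1.
W-e[n] : ∀ n → W n 1 e[ suc n ∷ [] ] ≡ sgn n
W-e[n] n = trans (W-e⊛′ n n (e 0) e₀-ignoresZeros)
  (trans (down-diag n (Yn 0 (e 0))) (*-identityʳ (sgn n)))

-- A second part keeps the index positive after the shift by the first, so `Y-Z` applies.
W-e[] : ∀ n μ → μ ⊢ suc n → μ ≢ suc n ∷ [] → W n 1 e[ μ ] ≡ 0ℚ
W-e[] n (zero ∷ μ)   (() ∷ _ , _ , _) _
W-e[] n (suc j ∷ []) (_ , _ , s) μ≢ = ⊥-elim (μ≢ (cong (_∷ []) (trans (sym (ℕ.+-identityʳ (suc j))) s)))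
W-e[] n (suc j ∷ zero ∷ μ)  (_ ∷ () ∷ _ , _ , _) _
W-e[] n (suc j ∷ suc i ∷ μ) (_ , _ , s) _ = begin
  W n 1 e[ suc j ∷ suc i ∷ μ ]         ≡⟨ W-e⊛′ n j H H-iz ⟩
  down j (Yn 0 H) n                    ≡⟨ cong (down j (Yn 0 H)) (ℕ.suc-injective s) ⟨
  down j (Yn 0 H) (j ℕ.+ suc (i ℕ.+ sum μ)) ≡⟨ down-zero j (i ℕ.+ sum μ) (Yn 0 H) (λ k → Y-Z k H (H-iz [])) ⟩
  0ℚ                                   ∎
  where
  H = e[ suc i ∷ μ ]
  H-iz = e[]-ignoresZeros (suc i ∷ μ)

-- Subsets

subsets : Subset n → List (Subset n)
subsets []            = [] ∷ []
subsets (outside ∷ U) = map (outside ∷_) (subsets U)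
subsets (inside ∷ U)  = map (outside ∷_) (subsets U) ++ map (inside ∷_) (subsets U)

∑-subsets-outside : ∀ (U : Subset n) f → ∑ (subsets (outside ∷ U)) f ≡ ∑ (subsets U) (f ∘ (outside ∷_))
∑-subsets-outside U f = ∑-map (outside ∷_) (subsets U) f

∑-subsets-inside : ∀ (U : Subset n) f → ∑ (subsets (inside ∷ U)) f ≡
                   ∑ (subsets U) (f ∘ (outside ∷_)) + ∑ (subsets U) (f ∘ (inside ∷_))
∑-subsets-inside U f = trans (∑-++ (map (outside ∷_) (subsets U)) _ f)
  (cong₂ _+_ (∑-map (outside ∷_) (subsets U) f) (∑-map (inside ∷_) (subsets U) f))

subsets-⊆ : ∀ (U : Subset n) → All (_⊆ U) (subsets U)
subsets-⊆ []            = id ∷ []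
subsets-⊆ (outside ∷ U) = All.map⁺ (All.map (λ { S⊆U (there p) → there (S⊆U p) }) (subsets-⊆ U))
subsets-⊆ (inside ∷ U)  = All.++⁺
  (All.map⁺ (All.map (λ { S⊆U (there p) → there (S⊆U p) }) (subsets-⊆ U)))
  (All.map⁺ (All.map (λ { S⊆U here → here ; S⊆U (there p) → there (S⊆U p) }) (subsets-⊆ U)))

∣S∣+∣U─S∣ : ∀ (U : Subset n) → All (λ S → ∣ S ∣ ℕ.+ ∣ U ─ S ∣ ≡ ∣ U ∣) (subsets U)
∣S∣+∣U─S∣ []            = refl ∷ []
∣S∣+∣U─S∣ (outside ∷ U) = All.map⁺ (∣S∣+∣U─S∣ U)
∣S∣+∣U─S∣ (inside ∷ U)  = All.++⁺
  (All.map⁺ (All.map (λ {S} p → trans (ℕ.+-suc ∣ S ∣ _) (cong suc p)) (∣S∣+∣U─S∣ U)))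
  (All.map⁺ (All.map (cong suc) (∣S∣+∣U─S∣ U)))

∣p∣≡0⇒∉ : ∀ {p : Subset n} → ∣ p ∣ ≡ 0 → ∀ {x} → x ∉ p
∣p∣≡0⇒∉ {p = inside ∷ p}  () here
∣p∣≡0⇒∉ {p = inside ∷ p}  () (there x∈p)
∣p∣≡0⇒∉ {p = outside ∷ p} ∣p∣≡0 (there x∈p) = ∣p∣≡0⇒∉ ∣p∣≡0 x∈p

∉⇒∣p∣≡0 : ∀ (p : Subset n) → (∀ x → x ∉ p) → ∣ p ∣ ≡ 0
∉⇒∣p∣≡0 []            _ = refl
∉⇒∣p∣≡0 (inside ∷ p)  ∉ = contradiction here (∉ zero)
∉⇒∣p∣≡0 (outside ∷ p) ∉ = ∉⇒∣p∣≡0 p (λ x → ∉ (suc x) ∘ there)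

∣p∣≤1⇒≡ : ∀ {p : Subset n} → ∣ p ∣ ℕ.≤ 1 → ∀ {x y} → x ∈ p → y ∈ p → x ≡ y
∣p∣≤1⇒≡ {p = _}           _         here      here      = refl
∣p∣≤1⇒≡ {p = inside ∷ _}  (s≤s ∣p∣≤0) here      (there q) = contradiction q (∣p∣≡0⇒∉ (ℕ.n≤0⇒n≡0 ∣p∣≤0))
∣p∣≤1⇒≡ {p = inside ∷ _}  (s≤s ∣p∣≤0) (there p) _         = contradiction p (∣p∣≡0⇒∉ (ℕ.n≤0⇒n≡0 ∣p∣≤0))
∣p∣≤1⇒≡ {p = outside ∷ _} ∣p∣≤1     (there p) (there q) = cong suc (∣p∣≤1⇒≡ ∣p∣≤1 p q)

≡⇒∣p∣≤1 : ∀ (p : Subset n) → (∀ {x y} → x ∈ p → y ∈ p → x ≡ y) → ∣ p ∣ ℕ.≤ 1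
≡⇒∣p∣≤1 []            _ = z≤n
≡⇒∣p∣≤1 (inside ∷ p)  ≡ = s≤s (ℕ.≤-reflexive (∉⇒∣p∣≡0 p (λ x x∈p → Fin.0≢1+n (≡ here (there x∈p)))))
≡⇒∣p∣≤1 (outside ∷ p) ≡ = ≡⇒∣p∣≤1 p (λ x∈ y∈ → Fin.suc-injective (≡ (there x∈) (there y∈)))

∑-subsets-∅ : ∀ (U : Subset n) (f : Subset n → ℚ) → ∑[ S ← subsets U ] (𝟙 (∣ S ∣ ℕ.≟ 0) * f S) ≡ f ⊥
∑-subsets-∅ []            f = trans (+-identityʳ _) (*-identityˡ (f []))
∑-subsets-∅ (outside ∷ U) f = trans (∑-subsets-outside U _) (∑-subsets-∅ U (f ∘ (outside ∷_)))
∑-subsets-∅ (inside ∷ U)  f = trans (∑-subsets-inside U _)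
  (trans (cong₂ _+_ (∑-subsets-∅ U (f ∘ (outside ∷_))) (∑-zero (subsets U) (λ S → *-zeroˡ (f (inside ∷ S)))))
         (+-identityʳ _))

∑-subsets-singletons : ∀ (U : Subset n) → ∑[ S ← subsets U ] 𝟙 (∣ S ∣ ℕ.≟ 1) ≡ ι ∣ U ∣
∑-subsets-singletons []            = refl
∑-subsets-singletons (outside ∷ U) = trans (∑-subsets-outside U _) (∑-subsets-singletons U)
∑-subsets-singletons (inside ∷ U)  = begin
  ∑[ S ← subsets (inside ∷ U) ] 𝟙 (∣ S ∣ ℕ.≟ 1)
    ≡⟨ ∑-subsets-inside U _ ⟩
  ∑[ S ← subsets U ] 𝟙 (∣ S ∣ ℕ.≟ 1) + ∑[ S ← subsets U ] 𝟙 (suc ∣ S ∣ ℕ.≟ 1)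
    ≡⟨ cong₂ _+_ (∑-subsets-singletons U) (trans (∑-cong (subsets U) (λ S → trans
         (𝟙-cong (suc ∣ S ∣ ℕ.≟ 1) (∣ S ∣ ℕ.≟ 0) ℕ.suc-injective (cong suc)) (sym (*-identityʳ _))))
         (∑-subsets-∅ U (λ _ → 1ℚ))) ⟩
  ι ∣ U ∣ + 1ℚ
    ≡⟨ +-comm (ι ∣ U ∣) 1ℚ ⟩
  1ℚ + ι ∣ U ∣
    ≡⟨ ι-suc ∣ U ∣ ⟨
  ι (suc ∣ U ∣) ∎

∑-subsets-split : ∀ (T : Subset n) v f → ∑ (subsets (T [ v ]≔ inside)) f ≡
  ∑ (subsets (T [ v ]≔ outside)) f + ∑[ S ← subsets (T [ v ]≔ outside) ] f (S [ v ]≔ inside)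
∑-subsets-split (_ ∷ T) zero f = trans (∑-subsets-inside T f)
  (cong₂ _+_ (sym (∑-subsets-outside T f)) (sym (∑-subsets-outside T (λ S → f (S [ zero ]≔ inside)))))
∑-subsets-split (outside ∷ T) (suc v) f = trans (∑-subsets-outside (T [ v ]≔ inside) f)
  (trans (∑-subsets-split T v (f ∘ (outside ∷_)))
    (cong₂ _+_ (sym (∑-subsets-outside T′ f)) (sym (∑-subsets-outside T′ (λ S → f (S [ suc v ]≔ inside))))))
  where T′ = T [ v ]≔ outside
∑-subsets-split (inside ∷ T) (suc v) f = begin
  ∑ (subsets (inside ∷ T [ v ]≔ inside)) f
    ≡⟨ ∑-subsets-inside (T [ v ]≔ inside) f ⟩
  ∑ (subsets (T [ v ]≔ inside)) (f ∘ (outside ∷_)) + ∑ (subsets (T [ v ]≔ inside)) (f ∘ (inside ∷_))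
    ≡⟨ cong₂ _+_ (∑-subsets-split T v (f ∘ (outside ∷_))) (∑-subsets-split T v (f ∘ (inside ∷_))) ⟩
  (a + b) + (c + d)
    ≡⟨ solve 4 (λ a b c d → (a :+ b) :+ (c :+ d) := (a :+ c) :+ (b :+ d)) refl a b c d ⟩
  (a + c) + (b + d)
    ≡⟨ cong₂ _+_ (∑-subsets-inside T′ f) (∑-subsets-inside T′ (λ S → f (S [ suc v ]≔ inside))) ⟨
  ∑ (subsets (inside ∷ T′)) f + ∑[ S ← subsets (inside ∷ T′) ] f (S [ suc v ]≔ inside) ∎
  where
  T′ = T [ v ]≔ outside
  a = ∑[ S ← subsets T′ ] f (outside ∷ S)
  b = ∑[ S ← subsets T′ ] f (outside ∷ S [ v ]≔ inside)
  c = ∑[ S ← subsets T′ ] f (inside ∷ S)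
  d = ∑[ S ← subsets T′ ] f (inside ∷ S [ v ]≔ inside)

∑-subsets-∩ : ∀ (T R : Subset n) f → ∑[ S ← subsets T ] (𝟙 (S ⊆? R) * f S) ≡ ∑ (subsets (T ∩ R)) f
∑-subsets-∩ [] [] f = cong (_+ 0ℚ) (trans (cong (_* f []) (𝟙-yes ([] ⊆? []) id)) (*-identityˡ (f [])))
∑-subsets-∩ (outside ∷ T) (r ∷ R) f = trans (∑-subsets-outside T _)
  (trans (∑-cong (subsets T) (λ S → cong (_* f (outside ∷ S)) (𝟙-cong (outside ∷ S ⊆? r ∷ R) (S ⊆? R)
      drop-∷-⊆ (λ { S⊆R (there p) → there (S⊆R p) }))))
    (trans (∑-subsets-∩ T R (f ∘ (outside ∷_))) (sym (∑-subsets-outside (T ∩ R) f))))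
∑-subsets-∩ (inside ∷ T) (r ∷ R) f = trans (∑-subsets-inside T _)
  (trans (cong₂ _+_ (trans (∑-cong (subsets T) (λ S → cong (_* f (outside ∷ S)) (𝟙-cong (outside ∷ S ⊆? r ∷ R) (S ⊆? R)
      drop-∷-⊆ (λ { S⊆R (there p) → there (S⊆R p) })))) (∑-subsets-∩ T R (f ∘ (outside ∷_))))
      refl) (go r))
  where
  go : ∀ r → ∑ (subsets (T ∩ R)) (f ∘ (outside ∷_)) + ∑[ S ← subsets T ] (𝟙 (inside ∷ S ⊆? r ∷ R) * f (inside ∷ S))
             ≡ ∑ (subsets ((inside ∷ T) ∩ (r ∷ R))) f
  go inside = trans (cong (∑ (subsets (T ∩ R)) (f ∘ (outside ∷_)) +_)
    (trans (∑-cong (subsets T) (λ S → cong (_* f (inside ∷ S)) (𝟙-cong (inside ∷ S ⊆? inside ∷ R) (S ⊆? R)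
      drop-∷-⊆ (λ { S⊆R here → here ; S⊆R (there p) → there (S⊆R p) })))) (∑-subsets-∩ T R (f ∘ (inside ∷_)))))
    (sym (∑-subsets-inside (T ∩ R) f))
  go outside = trans (cong (∑ (subsets (T ∩ R)) (f ∘ (outside ∷_)) +_)
    (∑-zero (subsets T) (λ S → trans (cong (_* f (inside ∷ S))
      (𝟙-no (inside ∷ S ⊆? outside ∷ R) (λ ⊆ → contradiction (⊆ here) λ ()))) (*-zeroˡ (f (inside ∷ S))))))
    (trans (+-identityʳ _) (sym (∑-subsets-outside (T ∩ R) f)))

-- Turns the weight c₁ in `W` into the choice of a vertex in the first color class.
ι∣_∣ : ∀ (S : Subset n) → ι ∣ S ∣ ≡ ∑[ v ← allFin n ] 𝟙 (v ∈? S)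
ι∣ []          ∣ = refl
ι∣_∣ {suc n} (s ∷ S) = begin
  ι ∣ s ∷ S ∣
    ≡⟨ head s ⟩
  𝟙 (zero ∈? s ∷ S) + ι ∣ S ∣
    ≡⟨ cong (𝟙 (zero ∈? s ∷ S) +_) (trans ι∣ S ∣ (∑-cong (allFin n) (λ v → 𝟙-cong (v ∈? S) (suc v ∈? s ∷ S) there drop-there))) ⟩
  𝟙 (zero ∈? s ∷ S) + ∑[ v ← allFin n ] 𝟙 (suc v ∈? s ∷ S)
    ≡⟨ ∑-allFin-suc n (λ v → 𝟙 (v ∈? s ∷ S)) ⟨
  ∑[ v ← allFin (suc n) ] 𝟙 (v ∈? s ∷ S) ∎
  where
  head : ∀ s → ι ∣ s ∷ S ∣ ≡ 𝟙 (zero ∈? s ∷ S) + ι ∣ S ∣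
  head inside  = ι-suc ∣ S ∣
  head outside = sym (+-identityˡ (ι ∣ S ∣))

─-insert : ∀ (U S : Subset n) v → U ─ (S [ v ]≔ inside) ≡ (U [ v ]≔ outside) ─ S
─-insert (_ ∷ U) (inside ∷ S)  zero    = refl
─-insert (_ ∷ U) (outside ∷ S) zero    = refl
─-insert (_ ∷ U) (inside ∷ S)  (suc v) = cong (outside ∷_) (─-insert U S v)
─-insert (x ∷ U) (outside ∷ S) (suc v) = cong (x ∷_) (─-insert U S v)

remove-─ : ∀ (U S : Subset n) v → (U [ v ]≔ outside) ─ S ≡ (U ─ S) [ v ]≔ outside
remove-─ (_ ∷ U) (inside ∷ S)  zero    = refl
remove-─ (_ ∷ U) (outside ∷ S) zero    = refl
remove-─ (_ ∷ U) (inside ∷ S)  (suc v) = cong (outside ∷_) (remove-─ U S v)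
remove-─ (x ∷ U) (outside ∷ S) (suc v) = cong (x ∷_) (remove-─ U S v)

∣remove∣ : ∀ {U : Subset n} {v} → v ∈ U → suc ∣ U [ v ]≔ outside ∣ ≡ ∣ U ∣
∣remove∣ here = refl
∣remove∣ {U = inside ∷ _}  (there v∈U) = cong suc (∣remove∣ v∈U)
∣remove∣ {U = outside ∷ _} (there v∈U) = ∣remove∣ v∈U

∈-remove⁺ : ∀ {U : Subset n} {v w} → w ∈ U → w ≢ v → w ∈ U [ v ]≔ outside
∈-remove⁺ {U = U} {v} {w} w∈U w≢v = Vec.[]≔-minimal U w v w≢v w∈U

∉-remove : ∀ (U : Subset n) v → v ∉ U [ v ]≔ outside
∉-remove (_ ∷ U) zero    ()
∉-remove (_ ∷ U) (suc v) (there p) = ∉-remove U v p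

∈-insert⁺ : ∀ {S : Subset n} {v w} → w ∈ S → w ∈ S [ v ]≔ inside
∈-insert⁺ {v = zero}  here      = here
∈-insert⁺ {v = suc v} here      = here
∈-insert⁺ {v = zero}  (there p) = there p
∈-insert⁺ {v = suc v} (there p) = there (∈-insert⁺ p)

∈-insert⁻ : ∀ {S : Subset n} v {w} → w ∈ S [ v ]≔ inside → w ≡ v ⊎ w ∈ S
∈-insert⁻ {S = _ ∷ _} zero    here      = inj₁ refl
∈-insert⁻ {S = _ ∷ _} zero    (there p) = inj₂ (there p)
∈-insert⁻ {S = _ ∷ _} (suc v) here      = inj₂ here
∈-insert⁻ {S = _ ∷ _} (suc v) (there p) with ∈-insert⁻ v p
... | inj₁ refl = inj₁ refl
... | inj₂ q    = inj₂ (there q)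

remove-∉ : ∀ (T : Subset n) {v} → v ∉ T → T [ v ]≔ outside ≡ T
remove-∉ (outside ∷ T) {zero}  _   = refl
remove-∉ (inside ∷ T)  {zero}  v∉T = contradiction here v∉T
remove-∉ (x ∷ T)       {suc v} v∉T = cong (x ∷_) (remove-∉ T (v∉T ∘ there))

insert-∈ : ∀ {T : Subset n} {v} → v ∈ T → T [ v ]≔ inside ≡ T
insert-∈ here        = refl
insert-∈ (there v∈T) = cong (_ ∷_) (insert-∈ v∈T)

-- Partial colorings

-- Vertices outside the subgraph get `nothing`, so colorings of all induced subgraphs have the same
-- type.
Partial : ℕ → ℕ → Set
Partial n k = Vec (Maybe (Fin k)) n

partials : ∀ k → Subset n → List (Partial n k)
partials k []            = [] ∷ []
partials k (inside ∷ U)  = cartesianProductWith (λ c κ → just c ∷ κ) (allFin k) (partials k U)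
partials k (outside ∷ U) = map (nothing ∷_) (partials k U)

∑-partials-inside : ∀ (U : Subset n) f → ∑ (partials k (inside ∷ U)) f ≡
                    ∑[ c ← allFin k ] ∑[ κ ← partials k U ] f (just c ∷ κ)
∑-partials-inside {k = k} U f = ∑-cartesianProductWith _ (allFin k) (partials k U) f

∑-partials-outside : ∀ (U : Subset n) f → ∑ (partials k (outside ∷ U)) f ≡ ∑[ κ ← partials k U ] f (nothing ∷ κ)
∑-partials-outside {k = k} U f = ∑-map (nothing ∷_) (partials k U) f

∑-colorings : ∀ n k (f : Partial n k → ℚ) →
              ∑[ κ ← colorings n k ] f (Vec.tabulate (just ∘ κ)) ≡ ∑ (partials k ⊤) f
∑-colorings zero    k f = refl
∑-colorings (suc n) k f = begin
  ∑[ κ ← colorings (suc n) k ] f (Vec.tabulate (just ∘ κ))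
    ≡⟨ ∑-map (finToFun {k} {suc n}) (allFin (k ℕ.* k ℕ.^ n)) _ ⟩
  ∑[ i ← allFin (k ℕ.* k ℕ.^ n) ] g (Fin.remQuot (k ℕ.^ n) i)
    -- `finToFun` takes the color of the first vertex and the index of the remaining coloring from
    -- `remQuot`; indexing by `combine c j` separates the two.
    ≡⟨ ∑-allFin-* k (k ℕ.^ n) (g ∘ Fin.remQuot (k ℕ.^ n)) ⟩
  ∑[ c ← allFin k ] ∑[ j ← allFin (k ℕ.^ n) ] g (Fin.remQuot (k ℕ.^ n) (Fin.combine c j))
    ≡⟨ ∑-cong (allFin k) (λ c → ∑-cong (allFin (k ℕ.^ n)) (λ j → cong g (Fin.remQuot-combine c j))) ⟩
  ∑[ c ← allFin k ] ∑[ j ← allFin (k ℕ.^ n) ] g (c , j)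
    ≡⟨ ∑-cong (allFin k) (λ c → trans (sym (∑-map (finToFun {k} {n}) (allFin (k ℕ.^ n)) _)) (∑-colorings n k (f ∘ (just c ∷_)))) ⟩
  ∑[ c ← allFin k ] ∑[ κ ← partials k ⊤ ] f (just c ∷ κ)
    ≡⟨ ∑-partials-inside ⊤ f ⟨
  ∑ (partials k ⊤) f ∎
  where
  g : Fin k × Fin (k ℕ.^ n) → ℚ
  g (c , j) = f (just c ∷ Vec.tabulate (just ∘ finToFun j))

-- `paint S κ` overwrites `κ` on `S`. Only if `κ` is blank there does it keep all colors of `κ`, and
-- with them the color counts.
Blank : Subset n → Partial n k → Set
Blank S κ = ∀ v → v ∈ S → Vec.lookup κ v ≡ nothing

partials-blank : ∀ k (U S : Subset n) → All (Blank S) (partials k (U ─ S))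
partials-blank k []      []            = (λ _ ()) ∷ []
partials-blank k (x ∷ U) (inside ∷ S)  = All.map⁺ (All.map (λ { b zero here → refl ; b (suc v) (there p) → b v p }) (partials-blank k U S))
partials-blank k (outside ∷ U) (outside ∷ S) = All.map⁺ (All.map (λ { b (suc v) (there p) → b v p }) (partials-blank k U S))
partials-blank k (inside ∷ U) (outside ∷ S) = All.cartesianProductWith⁺ (setoid _) (setoid _) _ (allFin k) (partials k (U ─ S))
  (λ _ κ∈ → λ { (suc v) (there p) → All.lookup (partials-blank k U S) κ∈ v p })

shade : Side → Maybe (Fin k) → Maybe (Fin (suc k))
shade inside  _ = just zero
shade outside c = Maybe.map suc c

paint : Subset n → Partial n k → Partial n (suc k)
paint = Vec.zipWith shade

-- A coloring by k + 1 colors amounts to its first color class `S` and a coloring of the remaining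
-- vertices by k colors, shifted up by one.
∑-paint : ∀ (U : Subset n) (f : Partial n (suc k) → ℚ) →
          ∑ (partials (suc k) U) f ≡ ∑[ S ← subsets U ] ∑[ κ ← partials k (U ─ S) ] f (paint S κ)
∑-paint []            f = sym (+-identityʳ _)
∑-paint {k = k} (outside ∷ U) f = begin
  ∑ (partials (suc k) (outside ∷ U)) f
    ≡⟨ ∑-partials-outside U f ⟩
  ∑ (partials (suc k) U) (f ∘ (nothing ∷_))
    ≡⟨ ∑-paint U (f ∘ (nothing ∷_)) ⟩
  ∑[ S ← subsets U ] ∑[ κ ← partials k (U ─ S) ] f (nothing ∷ paint S κ)
    ≡⟨ ∑-cong (subsets U) (λ S → sym (∑-partials-outside (U ─ S) _)) ⟩
  ∑[ S ← subsets U ] ∑[ κ ← partials k ((outside ∷ U) ─ (outside ∷ S)) ] f (paint (outside ∷ S) κ)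
    ≡⟨ ∑-subsets-outside U _ ⟨
  ∑[ S ← subsets (outside ∷ U) ] ∑[ κ ← partials k ((outside ∷ U) ─ S) ] f (paint S κ) ∎
∑-paint {k = k} (inside ∷ U) f = begin
  ∑ (partials (suc k) (inside ∷ U)) f
    ≡⟨ ∑-partials-inside U f ⟩
  ∑[ c ← allFin (suc k) ] ∑[ κ ← partials (suc k) U ] f (just c ∷ κ)
    ≡⟨ ∑-cong (allFin (suc k)) (λ c → ∑-paint U (f ∘ (just c ∷_))) ⟩
  ∑[ c ← allFin (suc k) ] h c
    ≡⟨ ∑-allFin-suc k h ⟩
  h zero + ∑[ c ← allFin k ] h (suc c)
    -- `subsets` lists the sets avoiding the head vertex first, and these belong to the colors
    -- `suc c`.
    ≡⟨ +-comm (h zero) _ ⟩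
  ∑[ c ← allFin k ] h (suc c) + h zero
    ≡⟨ cong (_+ h zero) (∑-swap (allFin k) (subsets U) _) ⟩
  ∑[ S ← subsets U ] ∑[ c ← allFin k ] ∑[ κ ← partials k (U ─ S) ] f (just (suc c) ∷ paint S κ) + h zero
    ≡⟨ cong₂ _+_ (∑-cong (subsets U) (λ S → sym (∑-partials-inside (U ─ S) (f ∘ paint (outside ∷ S)))))
         (∑-cong (subsets U) (λ S → sym (∑-partials-outside (U ─ S) (f ∘ paint (inside ∷ S))))) ⟩
  ∑[ S ← subsets U ] g (outside ∷ S) + ∑[ S ← subsets U ] g (inside ∷ S)
    ≡⟨ ∑-subsets-inside U g ⟨
  ∑ (subsets (inside ∷ U)) g ∎
  where
  h : Fin (suc k) → ℚ
  h c = ∑[ S ← subsets U ] ∑[ κ ← partials k (U ─ S) ] f (just c ∷ paint S κ)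
  g : Subset (suc _) → ℚ
  g S = ∑[ κ ← partials k ((inside ∷ U) ─ S) ] f (paint S κ)

paint-∈ : ∀ {S : Subset n} (κ : Partial n k) {v} → v ∈ S → Vec.lookup (paint S κ) v ≡ just zero
paint-∈ (c ∷ κ) here      = refl
paint-∈ (c ∷ κ) (there p) = paint-∈ κ p

paint-zero : ∀ (S : Subset n) (κ : Partial n k) v → Vec.lookup (paint S κ) v ≡ just zero → v ∈ S
paint-zero (inside ∷ S)  (c ∷ κ)       zero    _  = here
paint-zero (outside ∷ S) (just c ∷ κ)  zero    ()
paint-zero (outside ∷ S) (nothing ∷ κ) zero    ()
paint-zero (s ∷ S)       (c ∷ κ)       (suc v) eq = there (paint-zero S κ v eq)

paint-suc⁺ : ∀ (S : Subset n) (κ : Partial n k) → Blank S κ → ∀ v {c} →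
             Vec.lookup κ v ≡ just c → Vec.lookup (paint S κ) v ≡ just (suc c)
paint-suc⁺ (inside ∷ S)  (c ∷ κ) b zero    eq = contradiction (trans (sym (b zero here)) eq) λ ()
paint-suc⁺ (outside ∷ S) (c ∷ κ) b zero    eq = cong (Maybe.map suc) eq
paint-suc⁺ (s ∷ S)       (c ∷ κ) b (suc v) eq = paint-suc⁺ S κ (λ v → b (suc v) ∘ there) v eq

paint-suc⁻ : ∀ (S : Subset n) (κ : Partial n k) v {c} →
             Vec.lookup (paint S κ) v ≡ just (suc c) → Vec.lookup κ v ≡ just c
paint-suc⁻ (inside ∷ S)  (c ∷ κ)       zero    ()
paint-suc⁻ (outside ∷ S) (just c ∷ κ)  zero    refl = refl
paint-suc⁻ (outside ∷ S) (nothing ∷ κ) zero    ()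
paint-suc⁻ (s ∷ S)       (c ∷ κ)       (suc v) eq   = paint-suc⁻ S κ v eq

uses : Partial n k → Fin k → ℕ
uses κ i = Vec.count (λ c → Maybe.≡-dec Fin._≟_ c (just i)) κ

uses-paint-zero : ∀ (S : Subset n) (κ : Partial n k) → uses (paint S κ) zero ≡ ∣ S ∣
uses-paint-zero []            []            = refl
uses-paint-zero (inside ∷ S)  (c ∷ κ)       = cong suc (uses-paint-zero S κ)
uses-paint-zero (outside ∷ S) (just c ∷ κ)  = uses-paint-zero S κ
uses-paint-zero (outside ∷ S) (nothing ∷ κ) = uses-paint-zero S κ

uses-paint-suc : ∀ (S : Subset n) (κ : Partial n k) → Blank S κ → ∀ i → uses (paint S κ) (suc i) ≡ uses κ i
uses-paint-suc []            []            b i = refl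
uses-paint-suc (inside ∷ S)  (just c ∷ κ)  b i = contradiction (b zero here) λ ()
uses-paint-suc (inside ∷ S)  (nothing ∷ κ) b i = uses-paint-suc S κ (λ v → b (suc v) ∘ there) i
uses-paint-suc (outside ∷ S) (nothing ∷ κ) b i = uses-paint-suc S κ (λ v → b (suc v) ∘ there) i
uses-paint-suc (outside ∷ S) (just c ∷ κ)  b i with does (c Fin.≟ i)
... | true  = cong suc (uses-paint-suc S κ (λ v → b (suc v) ∘ there) i)
... | false = uses-paint-suc S κ (λ v → b (suc v) ∘ there) i

uses-tabulate : ∀ {l} (κ : Fin n → Fin k) (h : Fin l → Fin n) i →
  length (filter (λ v → κ v Fin.≟ i) (tabulate h)) ≡ uses (Vec.tabulate (just ∘ κ ∘ h)) i
uses-tabulate {l = zero}  κ h i = refl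
uses-tabulate {l = suc l} κ h i with does (κ (h zero) Fin.≟ i)
... | true  = cong suc (uses-tabulate κ (h ∘ suc) i)
... | false = uses-tabulate κ (h ∘ suc) i

-- Chromatic symmetric functions of induced subgraphs

module _ (G : Graph n) where
  open Graph G

  Stable : Subset n → Set
  Stable S = ∀ u v → u ∈ S → v ∈ S → ¬ u ~ v

  stable? : ∀ S → Dec (Stable S)
  stable? S = Fin.all? λ u → Fin.all? λ v → u ∈? S →-dec v ∈? S →-dec ¬? (u ~? v)

  Layer : ℕ → Subset n → Set
  Layer a S = Stable S × ∣ S ∣ ≡ a

  layer? : ∀ a S → Dec (Layer a S)
  layer? a S = stable? S ×-dec ∣ S ∣ ℕ.≟ a

  -- κ is a proper coloring, with monomial m, of the subgraph induced on the
  -- vertices that it colors.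
  Good : (m : Monomial) → Partial n (length m) → Set
  Good m κ = (∀ u v → u ~ v → ∀ c → Vec.lookup κ u ≡ just c → Vec.lookup κ v ≢ just c)
           × (∀ i → uses κ i ≡ lookup m i)

  good? : ∀ m κ → Dec (Good m κ)
  good? m κ =
    (Fin.all? λ u → Fin.all? λ v → u ~? v →-dec Fin.all? λ c →
      Maybe.≡-dec Fin._≟_ (Vec.lookup κ u) (just c) →-dec ¬? (Maybe.≡-dec Fin._≟_ (Vec.lookup κ v) (just c)))
    ×-dec (Fin.all? λ i → uses κ i ℕ.≟ lookup m i)

  good-paint⁻ : ∀ {S a m κ} → Blank S κ → Good (a ∷ m) (paint S κ) → Layer a S × Good m κ
  good-paint⁻ {S} {a} {m} {κ} b (proper , content) =
    ( (λ u v u∈S v∈S u~v → proper u v u~v zero (paint-∈ κ u∈S) (paint-∈ κ v∈S))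
    , trans (sym (uses-paint-zero S κ)) (content zero)) ,
    ( (λ u v u~v c κu κv → proper u v u~v (suc c) (paint-suc⁺ S κ b u κu) (paint-suc⁺ S κ b v κv))
    , λ i → trans (sym (uses-paint-suc S κ b i)) (content (suc i)))

  good-paint⁺ : ∀ {S a m κ} → Blank S κ → Layer a S × Good m κ → Good (a ∷ m) (paint S κ)
  good-paint⁺ {S} {a} {m} {κ} b ((stable , ∣S∣≡a) , (proper , content)) =
    (λ { u v u~v zero κu κv → stable u v (paint-zero S κ u κu) (paint-zero S κ v κv) u~v
       ; u v u~v (suc c) κu κv → proper u v u~v c (paint-suc⁻ S κ u κu) (paint-suc⁻ S κ v κv) }) ,
    (λ { zero → trans (uses-paint-zero S κ) ∣S∣≡a
       ; (suc i) → trans (uses-paint-suc S κ b i) (content i) })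

  -- The chromatic symmetric function of the subgraph induced on U.
  N : Subset n → Series
  N U m = ∑[ κ ← partials (length m) U ] 𝟙 (good? m κ)

  X≈N⊤ : X G ≈ N ⊤
  X≈N⊤ m = begin
    X G m
      ≡⟨ ι-filter (λ κ → proper? G κ ×-dec hasContent? m κ) (colorings n (length m)) ⟩
    ∑[ κ ← colorings n (length m) ] 𝟙 (proper? G κ ×-dec hasContent? m κ)
      ≡⟨ ∑-cong (colorings n (length m)) (λ κ →
           𝟙-cong (proper? G κ ×-dec hasContent? m κ) (good? m (Vec.tabulate (just ∘ κ))) (to κ) (from κ)) ⟩
    ∑[ κ ← colorings n (length m) ] 𝟙 (good? m (Vec.tabulate (just ∘ κ)))
      ≡⟨ ∑-colorings n (length m) (λ κ → 𝟙 (good? m κ)) ⟩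
    N ⊤ m ∎
    where
    to : ∀ κ → Proper G κ × HasContent m κ → Good m (Vec.tabulate (just ∘ κ))
    to κ (proper , content) =
      (λ u v u~v c κu κv → proper u v u~v (Maybe.just-injective
        (trans (trans (sym (Vec.lookup∘tabulate (just ∘ κ) u)) κu)
               (sym (trans (sym (Vec.lookup∘tabulate (just ∘ κ) v)) κv))))) ,
      (λ i → trans (sym (uses-tabulate κ id i)) (content i))
    from : ∀ κ → Good m (Vec.tabulate (just ∘ κ)) → Proper G κ × HasContent m κ
    from κ (proper , content) =
      (λ u v u~v κu≡κv → proper u v u~v (κ u) (Vec.lookup∘tabulate (just ∘ κ) u)
        (trans (Vec.lookup∘tabulate (just ∘ κ) v) (cong just (sym κu≡κv)))) ,
      (λ i → trans (uses-tabulate κ id i) (content i))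

  -- The exponent of x₁ is the size of the first color class, which may be any stable set; the other
  -- colors properly color what remains.
  N-∷ : ∀ U a m → N U (a ∷ m) ≡ ∑[ S ← subsets U ] (𝟙 (layer? a S) * N (U ─ S) m)
  N-∷ U a m = trans (∑-paint U (λ κ → 𝟙 (good? (a ∷ m) κ))) (∑-cong (subsets U) (λ S → trans
    (∑-congᴬ (All.map (λ {κ} b → trans
      (𝟙-cong (good? (a ∷ m) (paint S κ)) (layer? a S ×-dec good? m κ) (good-paint⁻ b) (good-paint⁺ b))
      (𝟙-× (layer? a S) (good? m κ))) (partials-blank (length m) U S)))
    (sym (∑-*ˡ (𝟙 (layer? a S)) (partials (length m) (U ─ S)) (λ κ → 𝟙 (good? m κ))))))

  -- Provides the hypothesis of `Y-Z` used in `noSink-full`.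
  N-zero∷ : ∀ U → N U ⟨ 0 ⟩ ≈ N U
  N-zero∷ U m = begin
    N U (0 ∷ m)
      ≡⟨ N-∷ U 0 m ⟩
    ∑[ S ← subsets U ] (𝟙 (layer? 0 S) * N (U ─ S) m)
      ≡⟨ ∑-cong (subsets U) (λ S → cong (_* N (U ─ S) m) (𝟙-cong (layer? 0 S) (∣ S ∣ ℕ.≟ 0) proj₂
           (λ ∣S∣≡0 → (λ u v u∈S → contradiction u∈S (∣p∣≡0⇒∉ ∣S∣≡0)) , ∣S∣≡0))) ⟩
    ∑[ S ← subsets U ] (𝟙 (∣ S ∣ ℕ.≟ 0) * N (U ─ S) m)
      ≡⟨ ∑-subsets-∅ U (λ S → N (U ─ S) m) ⟩
    N (U ─ ⊥) m
      ≡⟨ cong (λ S → N S m) (p─⊥≡p U) ⟩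
    N U m ∎

-- The sign of the coefficient of e n in X G

module _ (G : Graph n) where
  open Graph G

  -- Unfolded, this is a signed count of the ordered partitions of `U` into nonempty stable sets. It
  -- equals (-1)^∣U∣ times the number of acyclic orientations of the subgraph induced on `U`.
  acyclic : Subset n → ℚ
  acyclic U = Z ∣ U ∣ (N G U)

  -- The hypothesis ties the index to sizes: a first class of size `b` leaves exactly `d` vertices,
  -- so `Z d` is `acyclic` of the rest.
  Z-layer : ∀ d b U → d ℕ.+ b ≡ ∣ U ∣ →
            Z d (N G U ⟨ b ⟩) ≡ ∑[ S ← subsets U ] (𝟙 (layer? G b S) * acyclic (U ─ S))
  Z-layer d b U d+b≡∣U∣ = begin
    Z d (N G U ⟨ b ⟩)
      ≡⟨ Z-cong d (N-∷ G U b) ⟩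
    Z d (∑ₛ (subsets U) (λ S → 𝟙 (layer? G b S) · N G (U ─ S)))
      ≡⟨ Z-∑ d (subsets U) (λ S → 𝟙 (layer? G b S) · N G (U ─ S)) ⟩
    ∑[ S ← subsets U ] Z d (𝟙 (layer? G b S) · N G (U ─ S))
      ≡⟨ ∑-cong (subsets U) (λ S → Z-· d (𝟙 (layer? G b S)) (N G (U ─ S))) ⟩
    ∑[ S ← subsets U ] (𝟙 (layer? G b S) * Z d (N G (U ─ S)))
      ≡⟨ ∑-congᴬ (All.map (λ {S} p → term S p (layer? G b S)) (∣S∣+∣U─S∣ U)) ⟩
    ∑[ S ← subsets U ] (𝟙 (layer? G b S) * acyclic (U ─ S)) ∎
    where
    term : ∀ S → ∣ S ∣ ℕ.+ ∣ U ─ S ∣ ≡ ∣ U ∣ → (d? : Dec (Layer G b S)) →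
           𝟙 d? * Z d (N G (U ─ S)) ≡ 𝟙 d? * acyclic (U ─ S)
    term S p (no _) = trans (*-zeroˡ (Z d (N G (U ─ S)))) (sym (*-zeroˡ (acyclic (U ─ S))))
    term S p (yes (_ , refl)) = cong (λ x → 1ℚ * Z x (N G (U ─ S)))
      (ℕ.+-cancelʳ-≡ (∣ S ∣) d (∣ U ─ S ∣) (trans d+b≡∣U∣ (trans (sym p) (ℕ.+-comm ∣ S ∣ ∣ U ─ S ∣))))

  upper? : ∀ b S → Dec (Stable G S × b ℕ.≤ ∣ S ∣)
  upper? b S = stable? G S ×-dec b ℕ.≤? ∣ S ∣

  upper-step : ∀ b S → 𝟙 (upper? b S) ≡ 𝟙 (upper? (suc b) S) + 𝟙 (layer? G b S)
  upper-step b S = begin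
    𝟙 (upper? b S)                                      ≡⟨ 𝟙-× (stable? G S) (b ℕ.≤? ∣ S ∣) ⟩
    s * 𝟙 (b ℕ.≤? ∣ S ∣)                                ≡⟨ cong (s *_) (go (ℕ.<-cmp b ∣ S ∣)) ⟩
    s * (𝟙 (suc b ℕ.≤? ∣ S ∣) + 𝟙 (∣ S ∣ ℕ.≟ b))        ≡⟨ *-distribˡ-+ s _ _ ⟩
    s * 𝟙 (suc b ℕ.≤? ∣ S ∣) + s * 𝟙 (∣ S ∣ ℕ.≟ b)      ≡⟨ cong₂ _+_ (𝟙-× (stable? G S) (suc b ℕ.≤? ∣ S ∣)) (𝟙-× (stable? G S) (∣ S ∣ ℕ.≟ b)) ⟨
    𝟙 (upper? (suc b) S) + 𝟙 (layer? G b S)             ∎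
    where
    s = 𝟙 (stable? G S)
    go : Tri (b ℕ.< ∣ S ∣) (b ≡ ∣ S ∣) (b ℕ.> ∣ S ∣) → 𝟙 (b ℕ.≤? ∣ S ∣) ≡ 𝟙 (suc b ℕ.≤? ∣ S ∣) + 𝟙 (∣ S ∣ ℕ.≟ b)
    go (tri< < ≢ _) = trans (𝟙-yes (b ℕ.≤? ∣ S ∣) (ℕ.<⇒≤ <))
      (sym (cong₂ _+_ (𝟙-yes (suc b ℕ.≤? ∣ S ∣) <) (𝟙-no (∣ S ∣ ℕ.≟ b) (≢ ∘ sym))))
    go (tri≈ ≮ ≡ _) = trans (𝟙-yes (b ℕ.≤? ∣ S ∣) (ℕ.≤-reflexive ≡))
      (sym (cong₂ _+_ (𝟙-no (suc b ℕ.≤? ∣ S ∣) ≮) (𝟙-yes (∣ S ∣ ℕ.≟ b) (sym ≡))))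
    go (tri> ≮ ≢ >) = trans (𝟙-no (b ℕ.≤? ∣ S ∣) (ℕ.<⇒≱ >))
      (sym (cong₂ _+_ (𝟙-no (suc b ℕ.≤? ∣ S ∣) ≮) (𝟙-no (∣ S ∣ ℕ.≟ b) (≢ ∘ sym))))

  upper-split : ∀ b S x → 𝟙 (upper? (suc b) S) * x + 𝟙 (layer? G b S) * x ≡ 𝟙 (upper? b S) * x
  upper-split b S x = trans (sym (*-distribʳ-+ x (𝟙 (upper? (suc b) S)) (𝟙 (layer? G b S))))
    (cong (_* x) (sym (upper-step b S)))

  upper-top : ∀ {b S} U → ∣ S ∣ ℕ.+ ∣ U ─ S ∣ ≡ ∣ U ∣ → b ≡ ∣ U ∣ → 𝟙 (layer? G b S) ≡ 𝟙 (upper? b S)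
  upper-top {b} {S} U p refl = 𝟙-cong (layer? G b S) (upper? b S)
    (λ (stable , ∣S∣≡b) → stable , ℕ.≤-reflexive (sym ∣S∣≡b))
    (λ (stable , b≤∣S∣) → stable , ℕ.≤-antisym (subst (∣ S ∣ ℕ.≤_) p (ℕ.m≤m+n ∣ S ∣ ∣ U ─ S ∣)) b≤∣S∣)

  -- The bound c₁ ≥ b becomes b ≤ ∣S∣. The recursion raises `b` up to ∣U∣, where a subset of `U` of
  -- size at least `b` has size exactly `b`.
  Y-N : ∀ d b U → d ℕ.+ b ≡ ∣ U ∣ → Y d b (N G U) ≡ ∑[ S ← subsets U ] (𝟙 (upper? b S) * acyclic (U ─ S))
  Y-N zero b U b≡∣U∣ = trans (Z-layer 0 b U b≡∣U∣)
    (∑-congᴬ (All.map (λ {S} p → cong (_* acyclic (U ─ S)) (upper-top U p b≡∣U∣)) (∣S∣+∣U─S∣ U)))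
  Y-N (suc d) b U d+b≡∣U∣ = begin
    Y d (suc b) (N G U) + Z (suc d) (N G U ⟨ b ⟩)
      ≡⟨ cong₂ _+_ (Y-N d (suc b) U (trans (ℕ.+-suc d b) d+b≡∣U∣)) (Z-layer (suc d) b U d+b≡∣U∣) ⟩
    ∑[ S ← subsets U ] (𝟙 (upper? (suc b) S) * acyclic (U ─ S)) + ∑[ S ← subsets U ] (𝟙 (layer? G b S) * acyclic (U ─ S))
      ≡⟨ ∑-+ (subsets U) _ _ ⟨
    ∑[ S ← subsets U ] (𝟙 (upper? (suc b) S) * acyclic (U ─ S) + 𝟙 (layer? G b S) * acyclic (U ─ S))
      ≡⟨ ∑-cong (subsets U) (λ S → upper-split b S (acyclic (U ─ S))) ⟩
    ∑[ S ← subsets U ] (𝟙 (upper? b S) * acyclic (U ─ S)) ∎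

  ι-layer : ∀ b S x → ι b * (𝟙 (layer? G b S) * x) ≡ 𝟙 (layer? G b S) * (ι ∣ S ∣ * x)
  ι-layer b S x = go (layer? G b S)
    where
    go : (d? : Dec (Layer G b S)) → ι b * (𝟙 d? * x) ≡ 𝟙 d? * (ι ∣ S ∣ * x)
    go (yes (_ , refl)) = solve 2 (λ b x → b :* (con 1ℚ :* x) := con 1ℚ :* (b :* x)) refl (ι b) x
    go (no _)           = trans (cong (ι b *_) (*-zeroˡ x)) (trans (*-zeroʳ (ι b)) (sym (*-zeroˡ (ι ∣ S ∣ * x))))

  ι*Z-layer : ∀ d b U → d ℕ.+ b ≡ ∣ U ∣ →
    ι b * Z d (N G U ⟨ b ⟩) ≡ ∑[ S ← subsets U ] (𝟙 (layer? G b S) * (ι ∣ S ∣ * acyclic (U ─ S)))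
  ι*Z-layer d b U d+b≡∣U∣ = trans (cong (ι b *_) (Z-layer d b U d+b≡∣U∣))
    (trans (∑-*ˡ (ι b) (subsets U) _) (∑-cong (subsets U) (λ S → ι-layer b S (acyclic (U ─ S)))))

  W-N : ∀ d b U → d ℕ.+ b ≡ ∣ U ∣ →
        W d b (N G U) ≡ ∑[ S ← subsets U ] (𝟙 (upper? b S) * (ι ∣ S ∣ * acyclic (U ─ S)))
  W-N zero b U b≡∣U∣ = trans (ι*Z-layer 0 b U b≡∣U∣)
    (∑-congᴬ (All.map (λ {S} p → cong (_* (ι ∣ S ∣ * acyclic (U ─ S))) (upper-top U p b≡∣U∣)) (∣S∣+∣U─S∣ U)))
  W-N (suc d) b U d+b≡∣U∣ = begin
    W d (suc b) (N G U) + ι b * Z (suc d) (N G U ⟨ b ⟩)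
      ≡⟨ cong₂ _+_ (W-N d (suc b) U (trans (ℕ.+-suc d b) d+b≡∣U∣)) (ι*Z-layer (suc d) b U d+b≡∣U∣) ⟩
    ∑[ S ← subsets U ] (𝟙 (upper? (suc b) S) * x S) + ∑[ S ← subsets U ] (𝟙 (layer? G b S) * x S)
      ≡⟨ ∑-+ (subsets U) _ _ ⟨
    ∑[ S ← subsets U ] (𝟙 (upper? (suc b) S) * x S + 𝟙 (layer? G b S) * x S)
      ≡⟨ ∑-cong (subsets U) (λ S → upper-split b S (x S)) ⟩
    ∑[ S ← subsets U ] (𝟙 (upper? b S) * x S) ∎
    where
    x : Subset n → ℚ
    x S = ι ∣ S ∣ * acyclic (U ─ S)

  -- Up to the sign (-1)^∣U∣, the number of acyclic orientations of the
  -- subgraph induced on U that have no sink in T.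
  noSink : Subset n → Subset n → ℚ
  noSink U T = ∑[ S ← subsets T ] (𝟙 (stable? G S) * acyclic (U ─ S))

  -- A nonempty acyclic digraph has a sink. Algebraically, the sum is `Y` with bound 0, which
  -- cancels by `Y-Z`.
  noSink-full : ∀ U k → ∣ U ∣ ≡ suc k → noSink U U ≡ 0ℚ
  noSink-full U k ∣U∣≡suc = begin
    ∑[ S ← subsets U ] (𝟙 (stable? G S) * acyclic (U ─ S))
      ≡⟨ ∑-cong (subsets U) (λ S → cong (_* acyclic (U ─ S)) (𝟙-cong (stable? G S) (upper? 0 S) (_, z≤n) proj₁)) ⟩
    ∑[ S ← subsets U ] (𝟙 (upper? 0 S) * acyclic (U ─ S))
      ≡⟨ Y-N (suc k) 0 U (trans (ℕ.+-identityʳ (suc k)) (sym ∣U∣≡suc)) ⟨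
    Y (suc k) 0 (N G U)
      ≡⟨ Y-Z k (N G U) (N-zero∷ G U) ⟩
    0ℚ ∎

  0≤N : ∀ U m → 0ℚ ≤ N G U m
  0≤N U m = 0≤∑ (All.universal (λ κ → 0≤𝟙 (good? G m κ)) (partials (length m) U))

  noSink-empty : ∀ U T → T ⊆ U → ∣ U ∣ ≡ 0 → 0ℚ ≤ noSink U T
  noSink-empty U T T⊆U ∣U∣≡0 = 0≤∑ (All.universal (λ S → 0≤* (0≤𝟙 (stable? G S)) (0≤P S)) (subsets T))
    where
    0≤P : ∀ S → 0ℚ ≤ acyclic (U ─ S)
    0≤P S = subst (λ k → 0ℚ ≤ Z k (N G (U ─ S)))
      (sym (∉⇒∣p∣≡0 (U ─ S) (λ x x∈ → ∣p∣≡0⇒∉ ∣U∣≡0 (p─q⊆p U S x∈)))) (0≤N (U ─ S) [])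

  nonNeighbours : Fin n → Subset n
  nonNeighbours v = Vec.tabulate (λ w → does (¬? (v ~? w)))

  ∈-nonNeighbours⁺ : ∀ {v w} → ¬ v ~ w → w ∈ nonNeighbours v
  ∈-nonNeighbours⁺ {v} {w} v≁w = Vec.lookup⇒[]= w (nonNeighbours v)
    (trans (Vec.lookup∘tabulate _ w) (dec-true (¬? (v ~? w)) v≁w))

  ∈-nonNeighbours⁻ : ∀ {v w} → w ∈ nonNeighbours v → ¬ v ~ w
  ∈-nonNeighbours⁻ {v} {w} w∈ v~w = contradiction
    (trans (sym (trans (sym (Vec.lookup∘tabulate _ w)) (Vec.[]=⇒lookup w∈)))
           (dec-false (¬? (v ~? w)) (λ v≁w → v≁w v~w))) λ ()

  stable-insert⁻ : ∀ {S v} → Stable G (S [ v ]≔ inside) → S ⊆ nonNeighbours v × Stable G S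
  stable-insert⁻ {S} {v} stable =
    (λ {w} w∈S → ∈-nonNeighbours⁺ (stable v w (Vec.[]≔-updates S v) (∈-insert⁺ w∈S))) ,
    (λ u w u∈S w∈S → stable u w (∈-insert⁺ u∈S) (∈-insert⁺ w∈S))

  stable-insert⁺ : ∀ {S v} → S ⊆ nonNeighbours v × Stable G S → Stable G (S [ v ]≔ inside)
  stable-insert⁺ {S} {v} (S⊆ , stable) u w u∈ w∈ u~w with ∈-insert⁻ v u∈ | ∈-insert⁻ v w∈
  ... | inj₁ refl | inj₁ refl = ~-irr refl u~w
  ... | inj₁ refl | inj₂ w∈S  = ∈-nonNeighbours⁻ (S⊆ w∈S) u~w
  ... | inj₂ u∈S  | inj₁ refl = ∈-nonNeighbours⁻ (S⊆ u∈S) (~-sym u~w)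
  ... | inj₂ u∈S  | inj₂ w∈S  = stable u w u∈S w∈S u~w

  -- Adding `v` to `S` keeps it stable exactly when `S` is stable and contains no neighbour of `v`.
  noSink-insert : ∀ U T v →
    ∑[ S ← subsets T ] (𝟙 (stable? G (S [ v ]≔ inside)) * acyclic (U ─ (S [ v ]≔ inside)))
    ≡ noSink (U [ v ]≔ outside) (T ∩ nonNeighbours v)
  noSink-insert U T v = begin
    ∑[ S ← subsets T ] (𝟙 (stable? G (S [ v ]≔ inside)) * acyclic (U ─ (S [ v ]≔ inside)))
      ≡⟨ ∑-cong (subsets T) term ⟩
    ∑[ S ← subsets T ] (𝟙 (S ⊆? nonNeighbours v) * (𝟙 (stable? G S) * acyclic ((U [ v ]≔ outside) ─ S)))
      ≡⟨ ∑-subsets-∩ T (nonNeighbours v) _ ⟩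
    noSink (U [ v ]≔ outside) (T ∩ nonNeighbours v) ∎
    where
    term : ∀ S → 𝟙 (stable? G (S [ v ]≔ inside)) * acyclic (U ─ (S [ v ]≔ inside)) ≡
                 𝟙 (S ⊆? nonNeighbours v) * (𝟙 (stable? G S) * acyclic ((U [ v ]≔ outside) ─ S))
    term S = trans (cong₂ _*_
      (trans (𝟙-cong (stable? G (S [ v ]≔ inside)) (S ⊆? nonNeighbours v ×-dec stable? G S) stable-insert⁻ stable-insert⁺)
             (𝟙-× (S ⊆? nonNeighbours v) (stable? G S)))
      (cong acyclic (─-insert U S v)))
      (*-assoc (𝟙 (S ⊆? nonNeighbours v)) (𝟙 (stable? G S)) _)

  -- For `v` in `U` and `T` inside `U`, the last term accounts for the orientations in which `v` is
  -- a sink and no vertex of `T` is. Neighbours of `v` are then no sinks anyway, so after deleting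
  -- `v` only its non-neighbours in `T` stay constrained.
  noSink-split : ∀ U T v → v ∉ T → noSink U (T [ v ]≔ inside) ≡ noSink U T + noSink (U [ v ]≔ outside) (T ∩ nonNeighbours v)
  noSink-split U T v v∉T = begin
    noSink U (T [ v ]≔ inside)
      ≡⟨ ∑-subsets-split T v f ⟩
    ∑ (subsets (T [ v ]≔ outside)) f + ∑[ S ← subsets (T [ v ]≔ outside) ] f (S [ v ]≔ inside)
      ≡⟨ cong (λ T′ → ∑ (subsets T′) f + ∑[ S ← subsets T′ ] f (S [ v ]≔ inside)) (remove-∉ T v∉T) ⟩
    noSink U T + ∑[ S ← subsets T ] f (S [ v ]≔ inside)
      ≡⟨ cong (noSink U T +_) (noSink-insert U T v) ⟩
    noSink U T + noSink (U [ v ]≔ outside) (T ∩ nonNeighbours v) ∎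
    where
    f : Subset n → ℚ
    f S = 𝟙 (stable? G S) * acyclic (U ─ S)

  -- Lexicographic induction on the bounds `a` for ∣U∣ and `d` for ∣U ─ T∣: a vertex of `U` outside
  -- `T` is either added to `T` or deleted from `U`. At the end `T` is all of `U`; the value is then
  -- 0, or a sum of nonnegative terms if `U` is empty.
  0≤sgn*noSink′ : ∀ a d U T → ∣ U ∣ ℕ.≤ a → ∣ U ─ T ∣ ℕ.≤ d → T ⊆ U → 0ℚ ≤ sgn ∣ U ∣ * noSink U T
  0≤sgn*noSink′ a d U T ∣U∣≤a ∣U─T∣≤d T⊆U with Fin.any? (λ v → v ∈? U ×-dec ¬? (v ∈? T))
  ... | no none = full ∣ U ∣ refl
    where
    U⊆T : U ⊆ T
    U⊆T {v} v∈U with v ∈? T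
    ... | yes v∈T = v∈T
    ... | no v∉T  = contradiction (v , v∈U , v∉T) none
    full : ∀ k → ∣ U ∣ ≡ k → 0ℚ ≤ sgn k * noSink U T
    full zero    ∣U∣≡0   = subst (0ℚ ≤_) (sym (*-identityˡ (noSink U T))) (noSink-empty U T T⊆U ∣U∣≡0)
    full (suc k) ∣U∣≡suc = ≤-reflexive (sym (trans
      (cong (sgn (suc k) *_) (trans (cong (noSink U) (⊆-antisym T⊆U U⊆T)) (noSink-full U k ∣U∣≡suc)))
      (*-zeroʳ (sgn (suc k)))))
  ... | yes (v , v∈U , v∉T) = step a d ∣U∣≤a ∣U─T∣≤d
    where
    U′ = U [ v ]≔ outside
    R  = T ∩ nonNeighbours v

    suc∣U′∣≡∣U∣ : suc ∣ U′ ∣ ≡ ∣ U ∣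
    suc∣U′∣≡∣U∣ = ∣remove∣ v∈U

    ∣U─T+v∣ : suc ∣ U ─ (T [ v ]≔ inside) ∣ ≡ ∣ U ─ T ∣
    ∣U─T+v∣ = trans (cong (suc ∘ ∣_∣) (trans (─-insert U T v) (remove-─ U T v)))
      (∣remove∣ (x∈p∧x∉q⇒x∈p─q v∈U v∉T))

    T+v⊆U : T [ v ]≔ inside ⊆ U
    T+v⊆U w∈ with ∈-insert⁻ v w∈
    ... | inj₁ refl = v∈U
    ... | inj₂ w∈T  = T⊆U w∈T

    R⊆U′ : R ⊆ U′
    R⊆U′ w∈R with w∈T , _ ← x∈p∩q⁻ T (nonNeighbours v) w∈R = ∈-remove⁺ (T⊆U w∈T) (λ { refl → v∉T w∈T })

    -- `noSink-split` solved for `noSink U T`. The minus sign this creates is absorbed because `U′`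
    -- has one vertex fewer, so both summands fall under the induction.
    split : sgn ∣ U ∣ * noSink U T ≡ sgn ∣ U ∣ * noSink U (T [ v ]≔ inside) + sgn ∣ U′ ∣ * noSink U′ R
    split = begin
      sgn ∣ U ∣ * noSink U T
        ≡⟨ cong (λ k → sgn k * noSink U T) suc∣U′∣≡∣U∣ ⟨
      - s * noSink U T
        ≡⟨ solve 3 (λ s x y → :- s :* x := :- s :* (x :+ y) :+ s :* y) refl s (noSink U T) (noSink U′ R) ⟩
      - s * (noSink U T + noSink U′ R) + s * noSink U′ R
        ≡⟨ cong₂ (λ k x → sgn k * x + s * noSink U′ R) suc∣U′∣≡∣U∣ (sym (noSink-split U T v v∉T)) ⟩
      sgn ∣ U ∣ * noSink U (T [ v ]≔ inside) + s * noSink U′ R ∎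
      where s = sgn ∣ U′ ∣

    step : ∀ a d → ∣ U ∣ ℕ.≤ a → ∣ U ─ T ∣ ℕ.≤ d → 0ℚ ≤ sgn ∣ U ∣ * noSink U T
    step zero    d       ∣U∣≤0 _       = contradiction (ℕ.≤-trans (ℕ.≤-reflexive suc∣U′∣≡∣U∣) ∣U∣≤0) λ ()
    step (suc a) zero    _     ∣U─T∣≤0 = contradiction (ℕ.≤-trans (ℕ.≤-reflexive ∣U─T+v∣) ∣U─T∣≤0) λ ()
    step (suc a) (suc d) ∣U∣≤  ∣U─T∣≤  = subst (0ℚ ≤_) (sym split) (0≤+
      (0≤sgn*noSink′ (suc a) d U (T [ v ]≔ inside) ∣U∣≤ (ℕ.s≤s⁻¹ (ℕ.≤-trans (ℕ.≤-reflexive ∣U─T+v∣) ∣U─T∣≤)) T+v⊆U)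
      -- `∣ U′ ─ R ∣` may exceed `d`; this bound can start afresh because `a` has dropped.
      (0≤sgn*noSink′ a (∣ U′ ─ R ∣) U′ R (ℕ.s≤s⁻¹ (ℕ.≤-trans (ℕ.≤-reflexive suc∣U′∣≡∣U∣) ∣U∣≤)) ℕ.≤-refl R⊆U′))

  0≤sgn*noSink : ∀ U T → T ⊆ U → 0ℚ ≤ sgn ∣ U ∣ * noSink U T
  0≤sgn*noSink U T = 0≤sgn*noSink′ (∣ U ∣) (∣ U ─ T ∣) U T ℕ.≤-refl ℕ.≤-refl

  -- The summand of `v` describes orientations of the graph without `v` whose sinks are all
  -- neighbours of `v`. These stop being sinks once `v` is put back as a sink, which leaves `v` as
  -- the only one.
  W-N-vertices : ∀ d → suc d ≡ n → W d 1 (N G ⊤) ≡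
    ∑[ v ← allFin n ] noSink (⊤ [ v ]≔ outside) ((⊤ [ v ]≔ outside) ∩ nonNeighbours v)
  W-N-vertices d suc-d≡n = begin
    W d 1 (N G ⊤)
      -- A first exponent 0 has weight 0, so the bound may be lowered from 1 to 0; then `upper? 0`
      -- asks for stability alone.
      ≡⟨ trans (cong (W d 1 (N G ⊤) +_) (*-zeroˡ (Z (suc d) (N G ⊤ ⟨ 0 ⟩)))) (+-identityʳ _) ⟨
    W (suc d) 0 (N G ⊤)
      ≡⟨ W-N (suc d) 0 ⊤ (trans (ℕ.+-identityʳ (suc d)) (trans suc-d≡n (sym (∣⊤∣≡n n)))) ⟩
    ∑[ S ← subsets ⊤ ] (𝟙 (upper? 0 S) * (ι ∣ S ∣ * acyclic (⊤ ─ S)))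
      ≡⟨ ∑-cong (subsets ⊤) byVertex ⟩
    ∑[ S ← subsets ⊤ ] ∑[ v ← allFin n ] (𝟙 (v ∈? S) * f S)
      ≡⟨ ∑-swap (subsets ⊤) (allFin n) (λ S v → 𝟙 (v ∈? S) * f S) ⟩
    ∑[ v ← allFin n ] ∑[ S ← subsets ⊤ ] (𝟙 (v ∈? S) * f S)
      ≡⟨ ∑-cong (allFin n) containing ⟩
    ∑[ v ← allFin n ] noSink (⊤ [ v ]≔ outside) ((⊤ [ v ]≔ outside) ∩ nonNeighbours v) ∎
    where
    f : Subset n → ℚ
    f S = 𝟙 (stable? G S) * acyclic (⊤ ─ S)

    byVertex : ∀ S → 𝟙 (upper? 0 S) * (ι ∣ S ∣ * acyclic (⊤ ─ S)) ≡ ∑[ v ← allFin n ] (𝟙 (v ∈? S) * f S)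
    byVertex S = begin
      𝟙 (upper? 0 S) * (ι ∣ S ∣ * acyclic (⊤ ─ S))
        ≡⟨ cong₂ (λ x y → x * (y * acyclic (⊤ ─ S))) (𝟙-cong (upper? 0 S) (stable? G S) proj₁ (_, z≤n)) ι∣ S ∣ ⟩
      𝟙 (stable? G S) * (c * acyclic (⊤ ─ S))
        ≡⟨ solve 3 (λ s c p → s :* (c :* p) := c :* (s :* p)) refl (𝟙 (stable? G S)) c (acyclic (⊤ ─ S)) ⟩
      c * f S
        ≡⟨ ∑-*ʳ (f S) (allFin n) (λ v → 𝟙 (v ∈? S)) ⟩
      ∑[ v ← allFin n ] (𝟙 (v ∈? S) * f S) ∎
      where c = ∑[ v ← allFin n ] 𝟙 (v ∈? S)

    containing : ∀ v → ∑[ S ← subsets ⊤ ] (𝟙 (v ∈? S) * f S) ≡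
                       noSink (⊤ [ v ]≔ outside) ((⊤ [ v ]≔ outside) ∩ nonNeighbours v)
    containing v = begin
      ∑ (subsets ⊤) g
        ≡⟨ cong (λ T → ∑ (subsets T) g) (insert-∈ (∈⊤ {x = v})) ⟨
      ∑ (subsets (⊤ [ v ]≔ inside)) g
        ≡⟨ ∑-subsets-split ⊤ v g ⟩
      ∑ (subsets T) g + ∑[ S ← subsets T ] g (S [ v ]≔ inside)
        ≡⟨ cong₂ _+_
             (∑-zeroᴬ (All.map {P = _⊆ T} (λ {S} S⊆T → trans (cong (_* f S) (𝟙-no (v ∈? S) (λ v∈S → ∉-remove ⊤ v (S⊆T v∈S)))) (*-zeroˡ (f S)))
               (subsets-⊆ T)))
             (∑-cong (subsets T) (λ S → trans
               (cong (_* f (S [ v ]≔ inside)) (𝟙-yes (v ∈? (S [ v ]≔ inside)) (Vec.[]≔-updates S v)))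
               (*-identityˡ (f (S [ v ]≔ inside))))) ⟩
      0ℚ + ∑[ S ← subsets T ] f (S [ v ]≔ inside)
        ≡⟨ +-identityˡ _ ⟩
      ∑[ S ← subsets T ] f (S [ v ]≔ inside)
        ≡⟨ noSink-insert ⊤ T v ⟩
      noSink T (T ∩ nonNeighbours v) ∎
      where
      T = ⊤ [ v ]≔ outside
      g : Subset n → ℚ
      g S = 𝟙 (v ∈? S) * f S

0≤sgn*W-X : ∀ {d} (G : Graph (suc d)) → 0ℚ ≤ sgn d * W d 1 (X G)
0≤sgn*W-X {d} G = subst (0ℚ ≤_) (sym (begin
    sgn d * W d 1 (X G)
      ≡⟨ cong (sgn d *_) (trans (W-cong d 1 (X≈N⊤ G)) (W-N-vertices G d refl)) ⟩
    sgn d * ∑ (allFin (suc d)) a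
      ≡⟨ ∑-*ˡ (sgn d) (allFin (suc d)) a ⟩
    ∑[ v ← allFin (suc d) ] (sgn d * a v) ∎))
  (0≤∑ (All.universal (λ v → subst (λ k → 0ℚ ≤ sgn k * a v)
    (ℕ.suc-injective (trans (∣remove∣ (∈⊤ {x = v})) (∣⊤∣≡n (suc d))))
    (0≤sgn*noSink G (⊤ [ v ]≔ outside) _ (p∩q⊆p (⊤ [ v ]≔ outside) (nonNeighbours G v)))) (allFin (suc d))))
  where
  a : Fin (suc d) → ℚ
  a v = noSink G (⊤ [ v ]≔ outside) ((⊤ [ v ]≔ outside) ∩ nonNeighbours G v)

-- The complete graph

K-stable⁻ : ∀ {S : Subset n} → Stable (K n) S → ∣ S ∣ ℕ.≤ 1
K-stable⁻ {S = S} stable = ≡⇒∣p∣≤1 S (λ {u} {v} u∈S v∈S → go u∈S v∈S (u Fin.≟ v))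
  where
  go : ∀ {u v} → u ∈ S → v ∈ S → Dec (u ≡ v) → u ≡ v
  go _   _   (yes u≡v) = u≡v
  go u∈S v∈S (no u≢v)  = contradiction u≢v (stable _ _ u∈S v∈S)

K-stable⁺ : ∀ {S : Subset n} → ∣ S ∣ ℕ.≤ 1 → Stable (K n) S
K-stable⁺ ∣S∣≤1 u v u∈S v∈S u≢v = u≢v (∣p∣≤1⇒≡ ∣S∣≤1 u∈S v∈S)

-- Induction on the monomial, for all `U` at once. A color class has at most one vertex: an exponent
-- 1 deletes one of ∣U∣ vertices, which builds up the factorial, and a larger exponent is
-- impossible.
N-K : ∀ m (U : Subset n) → N (K n) U m ≡ ι (∣ U ∣ !) * e ∣ U ∣ m
N-K {n} [] U = trans (∑-cong (partials 0 U) (λ κ → 𝟙-yes (good? (K n) [] κ) ((λ _ _ _ ()) , (λ ())))) (go U)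
  where
  go : ∀ {n} (U : Subset n) → ∑[ κ ← partials 0 U ] 1ℚ ≡ ι (∣ U ∣ !) * e ∣ U ∣ []
  go []            = refl
  go (outside ∷ U) = trans (∑-partials-outside U _) (go U)
  -- With a vertex but no color the sum is empty, and an `e` of positive index has no constant term.
  go (inside ∷ U)  = sym (*-zeroʳ (ι (suc ∣ U ∣ !)))
N-K {n} (zero ∷ m) U = trans (N-zero∷ (K n) U m)
  (trans (N-K m U) (cong (ι (∣ U ∣ !) *_) (sym (e-zero∷ ∣ U ∣ m))))
N-K {n} (suc zero ∷ m) U = begin
  N (K n) U (1 ∷ m)
    ≡⟨ N-∷ (K n) U 1 m ⟩
  ∑[ S ← subsets U ] (𝟙 (layer? (K n) 1 S) * N (K n) (U ─ S) m)
    ≡⟨ ∑-congᴬ (All.map (λ {S} p → cong₂ _*_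
         (𝟙-cong (layer? (K n) 1 S) (∣ S ∣ ℕ.≟ 1) proj₂ (λ ∣S∣≡1 → K-stable⁺ (ℕ.≤-reflexive ∣S∣≡1) , ∣S∣≡1))
         (N-K m (U ─ S))) (∣S∣+∣U─S∣ U)) ⟩
  ∑[ S ← subsets U ] (𝟙 (∣ S ∣ ℕ.≟ 1) * g ∣ U ─ S ∣)
    ≡⟨ ∑-congᴬ (All.map (λ {S} p → term S p (∣ S ∣ ℕ.≟ 1)) (∣S∣+∣U─S∣ U)) ⟩
  -- `pred` makes the factor independent of `S`. For empty `U` it takes a junk value, which is
  -- multiplied by `ι 0`.
  ∑[ S ← subsets U ] (𝟙 (∣ S ∣ ℕ.≟ 1) * g (ℕ.pred ∣ U ∣))
    ≡⟨ ∑-*ʳ (g (ℕ.pred ∣ U ∣)) (subsets U) (λ S → 𝟙 (∣ S ∣ ℕ.≟ 1)) ⟨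
  (∑[ S ← subsets U ] 𝟙 (∣ S ∣ ℕ.≟ 1)) * g (ℕ.pred ∣ U ∣)
    ≡⟨ cong (_* g (ℕ.pred ∣ U ∣)) (∑-subsets-singletons U) ⟩
  ι ∣ U ∣ * g (ℕ.pred ∣ U ∣)
    ≡⟨ factorial ∣ U ∣ ⟩
  ι (∣ U ∣ !) * e ∣ U ∣ (1 ∷ m) ∎
  where
  g : ℕ → ℚ
  g k = ι (k !) * e k m
  term : ∀ S → ∣ S ∣ ℕ.+ ∣ U ─ S ∣ ≡ ∣ U ∣ → (d? : Dec (∣ S ∣ ≡ 1)) →
         𝟙 d? * g ∣ U ─ S ∣ ≡ 𝟙 d? * g (ℕ.pred ∣ U ∣)
  term S p (yes ∣S∣≡1) = cong (λ k → 1ℚ * g k)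
    (cong ℕ.pred (trans (cong (ℕ._+ ∣ U ─ S ∣) (sym ∣S∣≡1)) p))
  term S p (no _)      = trans (*-zeroˡ (g ∣ U ─ S ∣)) (sym (*-zeroˡ (g (ℕ.pred ∣ U ∣))))
  factorial : ∀ k → ι k * g (ℕ.pred k) ≡ ι (k !) * e k (1 ∷ m)
  factorial zero    = trans (*-zeroˡ (g 0)) (sym (trans (cong (ι 1 *_) (e₀-suc∷ 0 m)) (*-zeroʳ (ι 1))))
  factorial (suc k) = trans (sym (*-assoc (ι (suc k)) (ι (k !)) (e k m)))
    (cong₂ _*_ (sym (ι-* (suc k) (k !))) (sym (e-one∷ k m)))
N-K {n} (suc (suc a) ∷ m) U = begin
  N (K n) U (suc (suc a) ∷ m)
    ≡⟨ N-∷ (K n) U (suc (suc a)) m ⟩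
  ∑[ S ← subsets U ] (𝟙 (layer? (K n) (suc (suc a)) S) * N (K n) (U ─ S) m)
    ≡⟨ ∑-zero (subsets U) (λ S → trans (cong (_* N (K n) (U ─ S) m)
         (𝟙-no (layer? (K n) (suc (suc a)) S) (λ (stable , ∣S∣≡) →
           contradiction (ℕ.≤-trans (ℕ.≤-reflexive (sym ∣S∣≡)) (K-stable⁻ stable)) λ { (s≤s ()) })))
         (*-zeroˡ (N (K n) (U ─ S) m))) ⟩
  0ℚ
    ≡⟨ *-zeroʳ (ι (∣ U ∣ !)) ⟨
  ι (∣ U ∣ !) * 0ℚ
    ≡⟨ cong (ι (∣ U ∣ !) *_) (e-2+∷ ∣ U ∣ a m) ⟨
  ι (∣ U ∣ !) * e ∣ U ∣ (suc (suc a) ∷ m) ∎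

X-K : ∀ n → X (K n) ≈ ι (n !) · e n
X-K n m = trans (X≈N⊤ (K n) m) (trans (N-K m (⊤ {n})) (cong (λ k → ι (k !) * e k m) (∣⊤∣≡n n)))

-- Expansions

∈-listsOfLength : ∀ (xs : List A) k {ys} → ys ∈ₗ listsOfLength xs k → length ys ≡ k
∈-listsOfLength xs zero    (Any.here refl) = refl
∈-listsOfLength xs (suc k) ys∈
  with _ , _ , _ , zs∈ , refl ← ∈-cartesianProductWith⁻ _∷_ xs (listsOfLength xs k) ys∈
  = cong suc (∈-listsOfLength xs k zs∈)

listsOfLength-unique : ∀ {xs : List A} → Unique xs → ∀ k → Unique (listsOfLength xs k)
listsOfLength-unique u zero    = [] ∷ []
listsOfLength-unique u (suc k) = Unique.cartesianProductWith⁺ _∷_ List.∷-injective u (listsOfLength-unique u k)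

-- The blocks joined by `concatMap` hold lists of different lengths, hence are disjoint.
partitions-unique : ∀ n → Unique (partitions n)
partitions-unique n = Unique.filter⁺ (_⊢? n) (Unique.concat⁺
  (All.map⁺ (All.universal (listsOfLength-unique parts-unique) (upTo (suc n))))
  (AllPairs.map⁺ (AllPairs.map disjoint (Unique.upTo⁺ (suc n)))))
  where
  parts = map suc (upTo n)
  disjoint : ∀ {k l} → k ≢ l → Disjoint (listsOfLength parts k) (listsOfLength parts l)
  disjoint k≢l (∈k , ∈l) = k≢l (trans (sym (∈-listsOfLength parts _ ∈k)) (∈-listsOfLength parts _ ∈l))
  parts-unique = Unique.map⁺ ℕ.suc-injective (Unique.upTo⁺ n)

partitions-⊢ : ∀ n → All (_⊢ n) (partitions n)
partitions-⊢ n = All.all-filter (_⊢? n) (concatMap (listsOfLength (map suc (upTo n))) (upTo (suc n)))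

[n]⊢n : ∀ n → suc n ∷ [] ⊢ suc n
[n]⊢n n = _ ∷ [] , [-] , ℕ.+-identityʳ (suc n)

[n]∈partitions : ∀ n → suc n ∷ [] ∈ₗ partitions (suc n)
[n]∈partitions n = ∈-filter⁺ (_⊢? suc n)
  (∈-concatMap⁺ (listsOfLength (map suc (upTo (suc n)))) (Any.map (λ { refl →
      ∈-cartesianProductWith⁺ _∷_ (∈-map⁺ suc (∈-upTo⁺ (ℕ.n<1+n n))) (Any.here refl) }) (∈-upTo⁺ {suc (suc n)} (s≤s (s≤s z≤n)))))
  ([n]⊢n n)

[_]≟_ : ∀ n (μ : List ℕ) → Dec (μ ≡ n ∷ [])
[ n ]≟ μ = List.≡-dec ℕ._≟_ μ (n ∷ [])

∑-partitions-[n] : ∀ n (f : List ℕ → ℚ) → ∑[ μ ← partitions (suc n) ] (𝟙 ([ suc n ]≟ μ) * f μ) ≡ f (suc n ∷ [])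
∑-partitions-[n] n = ∑-pick [ suc n ]≟_ (λ p q → trans p (sym q)) (partitions-unique (suc n)) ([n]∈partitions n) refl

combination : (List ℕ → ℚ) → List (List ℕ) → Series
combination c = foldr (λ μ H → c μ · e[ μ ] ⊕ H) 0ₛ

combination-∑ : ∀ c μs → combination c μs ≈ ∑ₛ μs (λ μ → c μ · e[ μ ])
combination-∑ c []       m = refl
combination-∑ c (μ ∷ μs) m = cong (c μ * e[ μ ] m +_) (combination-∑ c μs m)

-- The left side does not mention `E`, so every expansion of `F` has the same coefficient of
-- `e (suc n)`, and its sign can be found from `F`.
W-expansion : ∀ n {F} (E : EExpansion (suc n) F) → W n 1 F ≡ sgn n * ([e suc n ∷ [] ] E)
W-expansion n {F} E = begin
  W n 1 F
    ≡⟨ W-cong n 1 (λ m → trans (expand m) (combination-∑ coeff (partitions (suc n)) m)) ⟩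
  W n 1 (∑ₛ (partitions (suc n)) (λ μ → coeff μ · e[ μ ]))
    ≡⟨ W-∑ n 1 (partitions (suc n)) (λ μ → coeff μ · e[ μ ]) ⟩
  ∑[ μ ← partitions (suc n) ] W n 1 (coeff μ · e[ μ ])
    ≡⟨ ∑-congᴬ (All.map (λ {μ} → term μ) (partitions-⊢ (suc n))) ⟩
  ∑[ μ ← partitions (suc n) ] (𝟙 ([ suc n ]≟ μ) * (sgn n * coeff μ))
    ≡⟨ ∑-partitions-[n] n (λ μ → sgn n * coeff μ) ⟩
  sgn n * coeff (suc n ∷ []) ∎
  where
  open EExpansion E
  term : ∀ μ → μ ⊢ suc n → W n 1 (coeff μ · e[ μ ]) ≡ 𝟙 ([ suc n ]≟ μ) * (sgn n * coeff μ)
  term μ μ⊢ = trans (W-· n 1 (coeff μ) e[ μ ]) (go ([ suc n ]≟ μ))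
    where
    go : (d : Dec (μ ≡ suc n ∷ [])) → coeff μ * W n 1 e[ μ ] ≡ 𝟙 d * (sgn n * coeff μ)
    go (yes refl) = trans (cong (coeff μ *_) (W-e[n] n))
      (trans (*-comm (coeff μ) (sgn n)) (sym (*-identityˡ (sgn n * coeff μ))))
    go (no μ≢)    = trans (cong (coeff μ *_) (W-e[] n μ μ⊢ μ≢))
      (trans (*-zeroʳ (coeff μ)) (sym (*-zeroˡ (sgn n * coeff μ))))

EExpansion-cong : ∀ {n F H} → F ≈ H → EExpansion n F → EExpansion n H
EExpansion-cong F≈H E = record { coeff = coeff; expand = λ m → trans (sym (F≈H m)) (expand m) }
  where open EExpansion E

0ₛ-expansion : ∀ n → EExpansion n 0ₛ
0ₛ-expansion n = record
  { coeff  = λ _ → 0ℚ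
  ; expand = λ m → sym (trans (combination-∑ (λ _ → 0ℚ) (partitions n) m)
               (∑-zero (partitions n) (λ μ → *-zeroˡ (e[ μ ] m))))
  }

-- The partition `suc n ∷ []` is listed exactly once, so raising its coefficient by `q` adds
-- `q · e (suc n)` to the series.
addTop : ∀ {n F} q → EExpansion (suc n) F → EExpansion (suc n) (F ⊕ q · e (suc n))
addTop {n} {F} q E = record { coeff = c; expand = λ m → sym (begin
    combination c (partitions (suc n)) m
      ≡⟨ combination-∑ c (partitions (suc n)) m ⟩
    ∑[ μ ← partitions (suc n) ] ((coeff μ + 𝟙 ([ suc n ]≟ μ) * q) * e[ μ ] m)
      ≡⟨ ∑-cong (partitions (suc n)) (λ μ → solve 4 (λ c d q x → (c :+ d :* q) :* x := c :* x :+ d :* (q :* x)) refl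
           (coeff μ) (𝟙 ([ suc n ]≟ μ)) q (e[ μ ] m)) ⟩
    ∑[ μ ← partitions (suc n) ] (coeff μ * e[ μ ] m + 𝟙 ([ suc n ]≟ μ) * (q * e[ μ ] m))
      ≡⟨ ∑-+ (partitions (suc n)) (λ μ → coeff μ * e[ μ ] m) _ ⟩
    ∑[ μ ← partitions (suc n) ] (coeff μ * e[ μ ] m) + ∑[ μ ← partitions (suc n) ] (𝟙 ([ suc n ]≟ μ) * (q * e[ μ ] m))
      ≡⟨ cong₂ _+_ (sym (trans (expand m) (combination-∑ coeff (partitions (suc n)) m)))
           (∑-partitions-[n] n (λ μ → q * e[ μ ] m)) ⟩
    F m + q * e[ suc n ∷ [] ] m
      ≡⟨ cong (λ x → F m + q * x) (e₀-identityʳ (suc n) m) ⟩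
    F m + q * e (suc n) m ∎) }
  where
  open EExpansion E
  c = λ μ → coeff μ + 𝟙 ([ suc n ]≟ μ) * q

addTop-[n] : ∀ {n F} q (E : EExpansion (suc n) F) → [e suc n ∷ [] ] (addTop q E) ≡ ([e suc n ∷ [] ] E) + q
addTop-[n] {n} q E = cong (([e suc n ∷ [] ] E) +_)
  (trans (cong (_* q) (𝟙-yes ([ suc n ]≟ (suc n ∷ [])) refl)) (*-identityˡ q))

addTop-≢[n] : ∀ {n F μ} q (E : EExpansion (suc n) F) → μ ≢ suc n ∷ [] → [e μ ] (addTop q E) ≡ [e μ ] E
addTop-≢[n] {n} {μ = μ} q E μ≢ = trans (cong (([e μ ] E) +_)
  (trans (cong (_* q) (𝟙-no ([ suc n ]≟ μ) μ≢)) (*-zeroˡ q))) (+-identityʳ _)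

addTop-positive : ∀ {n F} ((E , _) : EPositive (suc n) F) q →
                  0ℚ ≤ [e suc n ∷ [] ] (addTop q E) → EPositive (suc n) (F ⊕ q · e (suc n))
addTop-positive {n} (E , E≥0) q top≥0 = addTop q E , λ μ μ⊢ → go μ μ⊢ ([ suc n ]≟ μ)
  where
  go : ∀ μ → μ ⊢ suc n → Dec (μ ≡ suc n ∷ []) → 0ℚ ≤ [e μ ] (addTop q E)
  go μ μ⊢ (yes refl) = top≥0
  go μ μ⊢ (no μ≢)    = subst (0ℚ ≤_) (sym (addTop-≢[n] q E μ≢)) (E≥0 μ μ⊢)

EPositive-cong : ∀ {n F H} → F ≈ H → EPositive n F → EPositive n H
EPositive-cong F≈H (E , E≥0) = EExpansion-cong F≈H E , E≥0

-- The two implications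

≥ₑ⇒positive : ∀ {n} (G : Graph (suc n)) → G ≥ₑ K (suc n) → EPositive (suc n) (X G)
≥ₑ⇒positive {n} G G≥K = EPositive-cong ≈X (addTop-positive positive q top≥0)
  where
  open _≥ₑ_ G≥K
  c q : ℚ
  c = ([e suc n ∷ [] ] expansionˡ) * (1/ ([e suc n ∷ [] ] expansionʳ)) {{nonzero}}
  -- By `X-K`, the multiple of `e (suc n)` that was subtracted in forming `Xₑ`.
  q = c * ι (suc n !)

  ≈X : Xₑ G (K (suc n)) expansionˡ expansionʳ {{nonzero}} ⊕ q · e (suc n) ≈ X G
  ≈X m = begin
    X G m + - (c * X (K (suc n)) m) + q * e (suc n) m
      ≡⟨ cong (λ x → X G m + - (c * x) + q * e (suc n) m) (X-K (suc n) m) ⟩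
    X G m + - (c * (ι (suc n !) * e (suc n) m)) + q * e (suc n) m
      ≡⟨ solve 4 (λ x c k y → x :+ :- (c :* (k :* y)) :+ (c :* k) :* y := x) refl
           (X G m) c (ι (suc n !)) (e (suc n) m) ⟩
    X G m ∎

  -- Away from `e (suc n)` it has the nonnegative coefficients of the given expansion of `Xₑ`; the
  -- remaining one is read off `X G` through `W-expansion`.
  E : EExpansion (suc n) (X G)
  E = EExpansion-cong ≈X (addTop q (proj₁ positive))

  top≥0 : 0ℚ ≤ [e suc n ∷ [] ] E
  top≥0 = subst (0ℚ ≤_) (begin
    sgn n * W n 1 (X G)                  ≡⟨ cong (sgn n *_) (W-expansion n E) ⟩
    sgn n * (sgn n * ([e suc n ∷ [] ] E)) ≡⟨ *-assoc (sgn n) (sgn n) _ ⟨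
    sgn n * sgn n * ([e suc n ∷ [] ] E)   ≡⟨ cong (_* ([e suc n ∷ [] ] E)) (sgn² n) ⟩
    1ℚ * ([e suc n ∷ [] ] E)              ≡⟨ *-identityˡ _ ⟩
    [e suc n ∷ [] ] E                     ∎) (0≤sgn*W-X G)

positive⇒≥ₑ : ∀ {n} (G : Graph (suc n)) → EPositive (suc n) (X G) → G ≥ₑ K (suc n)
positive⇒≥ₑ {n} G (E , E≥0) = record
  { expansionˡ = E
  ; expansionʳ = EK
  ; nonzero    = h≢0
  ; positive   = EPositive-cong ≈Xₑ (addTop-positive (E , E≥0) (- g) top≥0)
  }
  where
  EK : EExpansion (suc n) (X (K (suc n)))
  EK = EExpansion-cong (λ m → trans (+-identityˡ _) (sym (X-K (suc n) m)))
         (addTop (ι (suc n !)) (0ₛ-expansion (suc n)))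
  g h : ℚ
  g = [e suc n ∷ [] ] E
  h = [e suc n ∷ [] ] EK

  h≡n! : h ≡ ι (suc n !)
  h≡n! = trans (addTop-[n] (ι (suc n !)) (0ₛ-expansion (suc n))) (+-identityˡ _)

  h≢0 : NonZero h
  h≢0 = subst NonZero (sym h≡n!)
    (pos⇒nonZero (ι (suc n !)) {{normalize-pos (suc n !) 1 {{_}} {{(suc n) ℕ.!≢0}}}})

  -- `h` is the factor of `e (suc n)` in `X (K (suc n))`, so it cancels the denominator of g / h.
  -- Subtracting `g` then makes the top coefficient exactly 0.
  ≈Xₑ : X G ⊕ (- g) · e (suc n) ≈ Xₑ G (K (suc n)) E EK {{h≢0}}
  ≈Xₑ m = cong (X G m +_) (sym (begin
    - (g * (1/ h) {{h≢0}} * X (K (suc n)) m)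
      ≡⟨ cong (λ x → - (g * (1/ h) {{h≢0}} * x)) (trans (X-K (suc n) m) (cong (_* y) (sym h≡n!))) ⟩
    - (g * (1/ h) {{h≢0}} * (h * y))
      ≡⟨ solve 4 (λ g r h y → :- (g :* r :* (h :* y)) := r :* h :* (:- g :* y)) refl g ((1/ h) {{h≢0}}) h y ⟩
    (1/ h) {{h≢0}} * h * (- g * y)
      ≡⟨ cong (_* (- g * y)) (*-inverseˡ h {{h≢0}}) ⟩
    1ℚ * (- g * y)
      ≡⟨ *-identityˡ _ ⟩
    - g * y ∎))
    where y = e (suc n) m

  top≥0 : 0ℚ ≤ [e suc n ∷ [] ] (addTop (- g) E)
  top≥0 = ≤-reflexive (sym (trans (addTop-[n] (- g) E) (+-inverseʳ g)))

theorem2p21 : ∀ (n : ℕ) → 1 ℕ.≤ n → (G : Graph n) → Connected G → (G ≥ₑ K n) ⇔ EPositive n (X G)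
theorem2p21 (suc n) _ G _ = mk⇔ (≥ₑ⇒positive G) (positive⇒≥ₑ G)
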